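{- Let $n$ and $b$ be integers with $1\le b<\frac{n}{2}-1$, and let $BT\in\mathcal{CT}^*_{n,b}$. Then \[ M_2(BT)\le\begin{cases} 4n+16b-12 & \text{if } 1\le b\le\frac{n-4}{5},\\ 6n+6b-20 & \text{if } \frac{n-4}{5}<b<\frac{n-2}{3},\\ 10n-6b-28 & \text{if } \frac{n-2}{3}\le b<\frac{3n-4}{7},\\ 16n-20b-36 & \text{if } \frac{3n-4}{7}\le b<\frac{n}{2}-1. \end{cases} \] Equality holds if and only if $BT\in\mathcal{BT}'_1(n,b)$ when $1\le b<\frac{n-2}{3}$, and $BT\in\mathcal{BT}'_2(n,b)$ when $\frac{n-2}{3}\le b<\frac{n}{2}-1$.
   Context: A chemical tree is a tree with maximum degree at most $4$; $d_v$ is the degree of $v$. A pendent vertex has degree $1$; a branching vertex has degree greater than $2$. A pendent path is a path $u_0\cdots u_r$ ($r\ge1$) with $u_0$ pendent, $u_r$ branching and all internal vertices of degree $2$; an internal path is such a path with both end vertices branching and all internal vertices of degree $2$; its length is $r$. $\mathcal{CT}^*_{n,b}$ is the class of all $n$-vertex chemical trees with exactly $b$ branching vertices. For $1\le b<\frac{n-2}{3}$, $\mathcal{BT}_1(n,b)$ is the set of trees in $\mathcal{CT}^*_{n,b}$ whose degree sequence has $b$ entries $4$, $n-3b-2$ entries $2$ and $2b+2$ entries $1$; for $\frac{n-2}{3}\le b<\frac{n}{2}-1$, $\mathcal{BT}_2(n,b)$ is the set of trees in $\mathcal{CT}^*_{n,b}$ whose degree sequence has $n-2b-2$ entries $4$,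 $3b-n+2$ entries $3$ and $n-b$ entries $1$. $\mathcal{BT}'_1(n,b)$ and $\mathcal{BT}'_2(n,b)$ are the subclasses of $\mathcal{BT}_1(n,b)$ and $\mathcal{BT}_2(n,b)$, respectively, of trees satisfying all of: (1) every internal path (if any) has length $1$; (2) if some pendent vertex is adjacent to a vertex of degree $4$, then there are no two adjacent vertices of degree $3$; (3) if some pendent vertex is adjacent to a branching vertex, then there is no pendent path of length greater than $2$; (4) every vertex of degree $3$ (if any) has at most one neighbor of degree $4$; (5) there is at least one vertex of degree $4$ and the subgraph induced by the vertices of degree $4$ is a tree. The second Zagreb index is $M_2(G)=\sum_{uv\in E(G)}d_ud_v$. -}

module Defs where

open import Data.Fin using (Fin)
import Data.Fin as Fin
open import Data.Integer using (+_) renaming (_-_ to _-ℤ_)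
open import Data.List using (List; _∷_; _∷ʳ_; length; map; filter; allFin; cartesianProduct)
open import Data.List.Relation.Unary.All using (All)
open import Data.List.Relation.Unary.Linked using (Linked)
open import Data.List.Relation.Unary.Unique.Propositional using (Unique)
open import Data.Nat using (ℕ; suc; _+_; _*_; _≤_; _>_; _<?_; _≟_)
open import Data.Nat.ListAction using (sum)
open import Data.Product using (_×_; _,_; ∃; ∃₂)
open import Data.Refinement using (Refinement; value)
open import Function using (_on_)
open import Level using (0ℓ)
open import Relation.Binary using (Rel; Symmetric; Irreflexive; Decidable)
open import Relation.Binary.Construct.Closure.ReflexiveTransitive using (Star)
open import Relation.Binary.PropositionalEquality using (_≡_; cong)
open import Relation.Nullary using (¬_)
open import Relation.Nullary.Decidable using (_×-dec_)

record SimpleGraph (V : Set) : Set₁ where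
  infix 4 _~_ _~?_
  field
    _~_    : Rel V 0ℓ
    ~-sym  : Symmetric _~_
    irrefl : Irreflexive _≡_ _~_
    _~?_   : Decidable _~_

module _ {V : Set} (G : SimpleGraph V) where
  open SimpleGraph G

  IsPath : List V → Set
  IsPath us = Linked _~_ us × Unique us

  -- u ∷ us lists the vertices of a cycle once each; appending u closes it.
  IsCycle : V → List V → Set
  IsCycle u us = 2 ≤ length us × Unique (u ∷ us) × Linked _~_ (u ∷ us ∷ʳ u)

  Connected : Set
  Connected = ∀ u v → Star _~_ u v

  Acyclic : Set
  Acyclic = ∀ u us → ¬ IsCycle u us

  IsTree : Set
  IsTree = Connected × Acyclic

  -- The proof components of a Refinement are irrelevant, so every vertex
  -- satisfying P occurs exactly once in the induced subgraph.
  induced : (P : V → Set) → SimpleGraph (Refinement V P)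
  induced P = record
    { _~_    = _~_ on value
    ; ~-sym  = ~-sym
    ; irrefl = λ u≡v → irrefl (cong value u≡v)
    ; _~?_   = λ u v → value u ~? value v
    }

module _ {n : ℕ} (G : SimpleGraph (Fin n)) where
  open SimpleGraph G

  degree : Fin n → ℕ
  degree v = length (filter (v ~?_) (allFin n))

  degreeSequence : List ℕ
  degreeSequence = map degree (allFin n)

  #entries : ℕ → ℕ
  #entries k = length (filter (_≟ k) degreeSequence)

  edges : List (Fin n × Fin n)
  edges = filter (λ (u , v) → (u Fin.<? v) ×-dec (u ~? v))
                 (cartesianProduct (allFin n) (allFin n))

  M₂ : ℕ
  M₂ = sum (map (λ (u , v) → degree u * degree v) edges)

  Pendent : Fin n → Set
  Pendent v = degree v ≡ 1

  Branching : Fin n → Set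
  Branching v = degree v > 2

  #branching : ℕ
  #branching = length (filter (λ v → 2 <? degree v) (allFin n))

  -- In the next three definitions us lists the internal vertices only.

  PendentPath : Fin n → List (Fin n) → Fin n → Set
  PendentPath u us w =
    IsPath G (u ∷ us ∷ʳ w) × Pendent u × Branching w × All (λ v → degree v ≡ 2) us

  InternalPath : Fin n → List (Fin n) → Fin n → Set
  InternalPath u us w =
    IsPath G (u ∷ us ∷ʳ w) × Branching u × Branching w × All (λ v → degree v ≡ 2) us

  pathLength : List (Fin n) → ℕ
  pathLength us = suc (length us)

  ChemicalTree : Set
  ChemicalTree = IsTree G × (∀ v → degree v ≤ 4)

  CT* : ℕ → Set
  CT* b = ChemicalTree × #branching ≡ b

  -- Integer subtraction avoids truncation. The prescribed multiplicities add
  -- up to n, so they determine the whole degree sequence.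

  BT₁ : ℕ → Set
  BT₁ b = CT* b
        × #entries 4 ≡ b
        × + #entries 2 ≡ + n -ℤ + (3 * b) -ℤ + 2
        × #entries 1 ≡ 2 * b + 2

  BT₂ : ℕ → Set
  BT₂ b = CT* b
        × + #entries 4 ≡ + n -ℤ + (2 * b) -ℤ + 2
        × + #entries 3 ≡ + (3 * b + 2) -ℤ + n
        × + #entries 1 ≡ + n -ℤ + b

  record Conditions : Set where
    field
      internalPathsShort : ∀ u us w → InternalPath u us w → pathLength us ≡ 1
      noAdjacent3s       : (∃₂ λ u v → u ~ v × Pendent u × degree v ≡ 4) →
                           ¬ (∃₂ λ u v → u ~ v × degree u ≡ 3 × degree v ≡ 3)
      noLongPendentPath  : (∃₂ λ u v → u ~ v × Pendent u × Branching v) →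
                           ¬ (∃ λ u → ∃₂ λ us w → PendentPath u us w × pathLength us > 2)
      atMostOne4         : ∀ v → degree v ≡ 3 →
                           length (filter (λ u → (v ~? u) ×-dec (degree u ≟ 4)) (allFin n)) ≤ 1
      has4               : ∃ λ v → degree v ≡ 4
      tree4              : IsTree (induced G (λ v → degree v ≡ 4))

  BT₁′ : ℕ → Set
  BT₁′ b = BT₁ b × Conditions

  BT₂′ : ℕ → Set
  BT₂′ b = BT₂ b × Conditions

{-# OPTIONS --safe #-}
module Submission where

-- Write n_i for the number of vertices of degree i and m_ij for the number of edges joining
-- degrees i and j.  In a forest a nonempty vertex set S spans at most |S| - 1 edges, with
-- equality iff S induces a tree.  Let s and t be the deficits in this inequality for the
-- branching vertices and for the vertices of degree 4.  Counting degrees, M₂ equals each of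
--   4n + 16b - 12  - (10 n₃ + 2s + 2t + m₃₃ + 2 m₁₄ + m₁₃)
--   6n +  6b - 20  - (3 n₃ + 4s + 2t + 2 m₂₂ + m₂₃ + 3 m₃₃ + m₃₄)
--   10n -  6b - 28 - (4 n₂ + 3s + 3t + 2 m₃₃ + 2 m₂₂ + m₂₃)
--   16n - 20b - 36 - (10 n₂ + s + t + 2 m₂₂ + m₂₃ + 2 m₂₄ + 2 m₁₄).
-- Hence all four bounds hold for all n and b, and equality means, in this order, that
-- t = 0 together with n₃ = m₁₄ = 0, n₃ = m₂₂ = 0, n₂ = m₃₃ = 0, n₂ = m₁₄ = 0: if n₃ = 0 or
-- n₂ = 0, then t = 0 already forces s = 0.  Condition (2) or (3) says that one of two bounds
-- is attained, and then so is the smaller one.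

open import Defs
open import Data.Bool using (true; false; if_then_else_)
open import Data.Fin using (Fin; zero; suc; toℕ)
import Data.Fin as Fin
import Data.Fin.Properties as Fin
import Data.Integer as ℤ
import Data.Integer.Properties as ℤ
open import Data.Irrelevant using ([_])
open import Data.List as List
  using (List; []; _∷_; _∷ʳ_; _++_; length; filter; allFin; tabulate; cartesianProduct)
open import Data.List.Membership.Propositional using (_∈_; _∉_)
open import Data.List.Membership.Propositional.Properties using (∈-lookup)
open import Data.List.Properties using (map-tabulate; map-++; map-∘; ∷ʳ-++; ++-assoc; length-++; length-map)
open import Data.List.Relation.Unary.All as All using (All; []; _∷_)
import Data.List.Relation.Unary.All.Properties as All
open import Data.List.Relation.Unary.AllPairs using ([]; _∷_)
open import Data.List.Relation.Unary.Any using (here; there)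
open import Data.List.Relation.Unary.Linked using (Linked; []; [-]; _∷_)
import Data.List.Relation.Unary.Linked.Properties as Linked
open import Data.List.Relation.Unary.Unique.Propositional using (Unique)
import Data.List.Relation.Unary.Unique.Propositional.Properties as Unique
open import Data.Nat
import Data.Nat.ListAction as ListAction
import Data.Nat.ListAction.Properties as ListAction
open import Data.Nat.Properties
open import Data.Nat.Tactic.RingSolver using (solve-∀)
open import Data.Product as Product using (_×_; _,_; ∃; ∃₂; proj₁; proj₂)
open import Data.Refinement using (Refinement; value; _,_)
open import Data.Sum as Sum using (_⊎_; inj₁; inj₂; [_,_]′)
open import Data.Unit using (tt)
open import Function using (_∘_; id; _⇔_; mk⇔; Equivalence)
open import Function.Construct.Composition using (_⇔-∘_)
open import Level using (0ℓ)
open import Relation.Binary using (tri<; tri≈; tri>)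
open import Relation.Binary.Construct.Closure.ReflexiveTransitive as Star using (Star; ε; _◅_; _◅◅_)
open import Relation.Binary.PropositionalEquality
open import Relation.Nullary using (¬_; Dec; yes; no; contradiction)
open import Relation.Nullary.Decidable
  using ( does; dec-true; dec-false; does-⇔; from-yes; decidable-stable; recompute; True; toWitness
        ; _×-dec_; _⊎-dec_; _→-dec_; ¬? )
open import Relation.Unary using (Pred; Decidable; U)
open import Relation.Unary.Properties using (U?)

open import Algebra.Properties.CommutativeSemigroup *-commutativeSemigroup using (x∙yz≈y∙xz)
open import Algebra.Properties.Semiring.Sum +-*-semiring
  using (sum; sum-syntax; sum-cong-≗; ∑-distrib-+; ∑-comm; *-distribˡ-sum; sum-replicate-zero)

private variable
  n : ℕ

-- Counting

⟦_⟧ : {A : Set} → Dec A → ℕ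
⟦ d ⟧ = if does d then 1 else 0

⟦⟧-yes : {A : Set} (d : Dec A) → A → ⟦ d ⟧ ≡ 1
⟦⟧-yes d a = cong (if_then 1 else 0) (dec-true d a)

⟦⟧-no : {A : Set} (d : Dec A) → ¬ A → ⟦ d ⟧ ≡ 0
⟦⟧-no d ¬a = cong (if_then 1 else 0) (dec-false d ¬a)

⟦⟧-⇔ : {A B : Set} → A ⇔ B → (a : Dec A) (b : Dec B) → ⟦ a ⟧ ≡ ⟦ b ⟧
⟦⟧-⇔ e a b = cong (if_then 1 else 0) (does-⇔ e a b)

⟦⟧-× : {A B : Set} (a : Dec A) (b : Dec B) → ⟦ a ×-dec b ⟧ ≡ ⟦ a ⟧ * ⟦ b ⟧
⟦⟧-× a b with does a | does b
... | true  | true  = refl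
... | true  | false = refl
... | false | _     = refl

count : {P : Pred (Fin n) 0ℓ} → Decidable P → ℕ
count {n} P? = ∑[ i < n ] ⟦ P? i ⟧

sum-δ : (v : Fin n) (f : Fin n → ℕ) → ∑[ u < n ] (⟦ u Fin.≟ v ⟧ * f u) ≡ f v
sum-δ {suc n} zero f = trans (cong₂ _+_ (*-identityˡ (f zero)) (sum-replicate-zero n)) (+-identityʳ _)
sum-δ {suc n} (suc v) f = sum-δ v (f ∘ suc)

sum≡0⇒≡0 : (f : Fin n → ℕ) → sum f ≡ 0 → ∀ i → f i ≡ 0
sum≡0⇒≡0 f eq zero    = m+n≡0⇒m≡0 (f zero) eq
sum≡0⇒≡0 f eq (suc i) = sum≡0⇒≡0 (f ∘ suc) (m+n≡0⇒n≡0 (f zero) eq) i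

≡0⇒sum≡0 : (f : Fin n → ℕ) → (∀ i → f i ≡ 0) → sum f ≡ 0
≡0⇒sum≡0 {n} f eq = trans (sum-cong-≗ eq) (sum-replicate-zero n)

sum>0⇒∃ : (f : Fin n → ℕ) → sum f > 0 → ∃ λ i → f i > 0
sum>0⇒∃ {suc n} f lt with f zero in eq
... | suc _ = zero , subst (_> 0) (sym eq) z<s
... | zero  = Product.map suc id (sum>0⇒∃ (f ∘ suc) lt)

length-filter-tabulate : {A : Set} {P : Pred A 0ℓ} (P? : Decidable P) (f : Fin n → A) →
                         length (filter P? (tabulate f)) ≡ count (P? ∘ f)
length-filter-tabulate {zero}  P? f = refl
length-filter-tabulate {suc n} P? f with does (P? (f zero))
... | true  = cong suc (length-filter-tabulate P? (f ∘ suc))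
... | false = length-filter-tabulate P? (f ∘ suc)

sum-filter : {A : Set} {P : Pred A 0ℓ} (P? : Decidable P) (f : A → ℕ) (xs : List A) →
             ListAction.sum (List.map f (filter P? xs)) ≡ ListAction.sum (List.map (λ x → ⟦ P? x ⟧ * f x) xs)
sum-filter P? f []       = refl
sum-filter P? f (x ∷ xs) with does (P? x)
... | true  = cong₂ _+_ (sym (+-identityʳ (f x))) (sum-filter P? f xs)
... | false = sum-filter P? f xs

sum-tabulate : {A : Set} (f : A → ℕ) (s : Fin n → A) → ListAction.sum (List.map f (tabulate s)) ≡ sum (f ∘ s)
sum-tabulate {zero}  f s = refl
sum-tabulate {suc n} f s = cong (f (s zero) +_) (sum-tabulate f (s ∘ suc))

sum-cartesianProduct : ∀ {m} {A B : Set} (f : A × B → ℕ) (s : Fin m → A) (t : Fin n → B) →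
                       ListAction.sum (List.map f (cartesianProduct (tabulate s) (tabulate t)))
                       ≡ ∑[ i < m ] ∑[ j < n ] f (s i , t j)
sum-cartesianProduct {m = zero}  f s t = refl
sum-cartesianProduct {m = suc m} f s t = begin
  ListAction.sum (List.map f (row ++ rest))
    ≡⟨ cong ListAction.sum (map-++ f row rest) ⟩
  ListAction.sum (List.map f row ++ List.map f rest)
    ≡⟨ ListAction.sum-++ (List.map f row) _ ⟩
  ListAction.sum (List.map f row) + ListAction.sum (List.map f rest)
    ≡⟨ cong₂ _+_ (cong ListAction.sum (map-∘ (tabulate t))) refl ⟨
  ListAction.sum (List.map (f ∘ (s zero ,_)) (tabulate t)) + ListAction.sum (List.map f rest)
    ≡⟨ cong₂ _+_ (sum-tabulate _ t) (sum-cartesianProduct f (s ∘ suc) t) ⟩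
  _ ∎
  where
  open ≡-Reasoning
  row  = List.map (s zero ,_) (tabulate t)
  rest = cartesianProduct (tabulate (s ∘ suc)) (tabulate t)

-- Degree sums over vertices and over edges

module Sums {n : ℕ} (G : SimpleGraph (Fin n)) where
  open SimpleGraph G

  d : Fin n → ℕ
  d = degree G

  V : (ℕ → ℕ) → ℕ
  V g = ∑[ v < n ] g (d v)

  -- Every edge contributes in both orders.
  E : (ℕ → ℕ → ℕ) → ℕ
  E f = ∑[ u < n ] ∑[ v < n ] (⟦ u ~? v ⟧ * f (d u) (d v))

  ~?-sym : ∀ u v → ⟦ u ~? v ⟧ ≡ ⟦ v ~? u ⟧
  ~?-sym u v = ⟦⟧-⇔ (mk⇔ ~-sym ~-sym) (u ~? v) (v ~? u)

  degree≡count : ∀ v → d v ≡ count (v ~?_)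
  degree≡count v = length-filter-tabulate (v ~?_) id

  #entries≡V : ∀ k → #entries G k ≡ V (λ i → ⟦ i ≟ k ⟧)
  #entries≡V k = trans (cong (length ∘ filter (_≟ k)) (map-tabulate id d))
                       (length-filter-tabulate (_≟ k) d)

  #branching≡V : #branching G ≡ V (λ i → ⟦ 2 <? i ⟧)
  #branching≡V = length-filter-tabulate (λ v → 2 <? d v) id

  V-cong : {g h : ℕ → ℕ} → (∀ v → g (d v) ≡ h (d v)) → V g ≡ V h
  V-cong eq = sum-cong-≗ eq

  V-+ : (g h : ℕ → ℕ) → V (λ i → g i + h i) ≡ V g + V h
  V-+ g h = ∑-distrib-+ (g ∘ d) (h ∘ d)

  V-* : ∀ c (g : ℕ → ℕ) → V (λ i → c * g i) ≡ c * V g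
  V-* c g = sym (*-distribˡ-sum c (g ∘ d))

  E-cong : {f g : ℕ → ℕ → ℕ} → (∀ {u v} → u ~ v → f (d u) (d v) ≡ g (d u) (d v)) → E f ≡ E g
  E-cong {f} {g} eq = sum-cong-≗ λ u → sum-cong-≗ λ v → pointwise u v
    where
    pointwise : ∀ u v → ⟦ u ~? v ⟧ * f (d u) (d v) ≡ ⟦ u ~? v ⟧ * g (d u) (d v)
    pointwise u v with u ~? v
    ... | yes u~v = cong (1 *_) (eq u~v)
    ... | no  _   = refl

  E-+ : (f g : ℕ → ℕ → ℕ) → E (λ i j → f i j + g i j) ≡ E f + E g
  E-+ f g = trans
    (sum-cong-≗ λ u → trans (sum-cong-≗ λ v → *-distribˡ-+ ⟦ u ~? v ⟧ (f (d u) (d v)) (g (d u) (d v)))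
                            (∑-distrib-+ {n} _ _))
    (∑-distrib-+ {n} _ _)

  E-* : ∀ c (f : ℕ → ℕ → ℕ) → E (λ i j → c * f i j) ≡ c * E f
  E-* c f = trans
    (sum-cong-≗ λ u → trans (sum-cong-≗ λ v → x∙yz≈y∙xz ⟦ u ~? v ⟧ c (f (d u) (d v)))
                            (sym (*-distribˡ-sum {n} c _)))
    (sym (*-distribˡ-sum {n} c _))

  E≡0⇒ : {f : ℕ → ℕ → ℕ} → E f ≡ 0 → ∀ {u v} → u ~ v → f (d u) (d v) ≡ 0
  E≡0⇒ {f} eq {u} {v} u~v = begin
    f (d u) (d v)                ≡⟨ *-identityˡ _ ⟨
    1 * f (d u) (d v)            ≡⟨ cong (_* f (d u) (d v)) (⟦⟧-yes (u ~? v) u~v) ⟨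
    ⟦ u ~? v ⟧ * f (d u) (d v)   ≡⟨ sum≡0⇒≡0 _ (sum≡0⇒≡0 _ eq u) v ⟩
    0                            ∎
    where open ≡-Reasoning

  E≡0⇐ : {f : ℕ → ℕ → ℕ} → (∀ {u v} → u ~ v → f (d u) (d v) ≡ 0) → E f ≡ 0
  E≡0⇐ {f} eq = trans (E-cong {f} {λ _ _ → 0} eq)
    (≡0⇒sum≡0 {n} _ λ u → ≡0⇒sum≡0 {n} _ λ v → *-zeroʳ ⟦ u ~? v ⟧)

  -- The row of `u` contains `h (d u)` once for each of its `d u` neighbours.
  E-tail : (h : ℕ → ℕ) → E (λ i _ → h i) ≡ V (λ i → i * h i)
  E-tail h = sum-cong-≗ λ u → begin
    ∑[ v < n ] (⟦ u ~? v ⟧ * h (d u))   ≡⟨ sum-cong-≗ (λ v → *-comm ⟦ u ~? v ⟧ (h (d u))) ⟩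
    ∑[ v < n ] (h (d u) * ⟦ u ~? v ⟧)   ≡⟨ *-distribˡ-sum {n} (h (d u)) _ ⟨
    h (d u) * count (u ~?_)             ≡⟨ cong (h (d u) *_) (degree≡count u) ⟨
    h (d u) * d u                       ≡⟨ *-comm (h (d u)) (d u) ⟩
    d u * h (d u)                       ∎
    where open ≡-Reasoning

  E-head : (h : ℕ → ℕ) → E (λ _ j → h j) ≡ V (λ i → i * h i)
  E-head h = trans (∑-comm {n} {n} _)
    (trans (sum-cong-≗ λ v → sum-cong-≗ λ u → cong (_* h (d v)) (~?-sym u v)) (E-tail h))

  E-ends : (h : ℕ → ℕ) → E (λ i j → h i + h j) ≡ V (λ i → 2 * (i * h i))
  E-ends h = begin
    E (λ i j → h i + h j)                         ≡⟨ E-+ (λ i _ → h i) (λ _ j → h j) ⟩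
    E (λ i _ → h i) + E (λ _ j → h j)             ≡⟨ cong₂ _+_ (E-tail h) (E-head h) ⟩
    V (λ i → i * h i) + V (λ i → i * h i)         ≡⟨ cong (V (λ i → i * h i) +_) (+-identityʳ _) ⟨
    2 * V (λ i → i * h i)                         ≡⟨ V-* 2 (λ i → i * h i) ⟨
    V (λ i → 2 * (i * h i))                       ∎
    where open ≡-Reasoning

  -- `M₂` lists every edge with its smaller end first. Adding the transposed sum supplies the other
  -- order, and the diagonal contributes nothing because there are no loops.
  2M₂≡E : 2 * M₂ G ≡ E _*_
  2M₂≡E = begin
    2 * M₂ G                     ≡⟨ cong (M₂ G +_) (+-identityʳ _) ⟩
    M₂ G + M₂ G                  ≡⟨ cong₂ _+_ half (trans half (∑-comm {n} {n} _)) ⟩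
    (∑[ u < n ] ∑[ v < n ] w u v) + (∑[ u < n ] ∑[ v < n ] w v u)
      ≡⟨ ∑-distrib-+ (λ u → ∑[ v < n ] w u v) _ ⟨
    ∑[ u < n ] ((∑[ v < n ] w u v) + (∑[ v < n ] w v u))
      ≡⟨ sum-cong-≗ (λ u → ∑-distrib-+ (w u) _) ⟨
    ∑[ u < n ] ∑[ v < n ] (w u v + w v u)
      ≡⟨ sum-cong-≗ (λ u → sum-cong-≗ λ v → both u v) ⟩
    E _*_                        ∎
    where
    open ≡-Reasoning
    w : Fin n → Fin n → ℕ
    w u v = ⟦ (u Fin.<? v) ×-dec (u ~? v) ⟧ * (d u * d v)

    half : M₂ G ≡ ∑[ u < n ] ∑[ v < n ] w u v
    half = trans (sum-filter (λ (u , v) → (u Fin.<? v) ×-dec (u ~? v)) _ (cartesianProduct (allFin n) (allFin n)))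
                 (sum-cartesianProduct {n} {n} _ id id)

    split : ∀ u v → ⟦ (u Fin.<? v) ×-dec (u ~? v) ⟧ + ⟦ (v Fin.<? u) ×-dec (v ~? u) ⟧ ≡ ⟦ u ~? v ⟧
    split u v with Fin.<-cmp u v
    ... | tri< u<v _ v≮u = trans (cong₂ _+_
            (⟦⟧-⇔ (mk⇔ proj₂ (u<v ,_)) ((u Fin.<? v) ×-dec (u ~? v)) (u ~? v))
            (⟦⟧-no ((v Fin.<? u) ×-dec (v ~? u)) (v≮u ∘ proj₁))) (+-identityʳ _)
    ... | tri> u≮v _ v<u = cong₂ _+_
            (⟦⟧-no ((u Fin.<? v) ×-dec (u ~? v)) (u≮v ∘ proj₁))
            (⟦⟧-⇔ (mk⇔ (~-sym ∘ proj₂) (λ e → v<u , ~-sym e)) ((v Fin.<? u) ×-dec (v ~? u)) (u ~? v))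
    ... | tri≈ u≮v u≡v v≮u = trans (cong₂ _+_
            (⟦⟧-no ((u Fin.<? v) ×-dec (u ~? v)) (u≮v ∘ proj₁))
            (⟦⟧-no ((v Fin.<? u) ×-dec (v ~? u)) (v≮u ∘ proj₁)))
            (sym (⟦⟧-no (u ~? v) (irrefl u≡v)))

    both : ∀ u v → w u v + w v u ≡ ⟦ u ~? v ⟧ * (d u * d v)
    both u v = begin
      w u v + ⟦ (v Fin.<? u) ×-dec (v ~? u) ⟧ * (d v * d u)
        ≡⟨ cong (λ x → w u v + ⟦ (v Fin.<? u) ×-dec (v ~? u) ⟧ * x) (*-comm (d v) (d u)) ⟩
      w u v + ⟦ (v Fin.<? u) ×-dec (v ~? u) ⟧ * (d u * d v)
        ≡⟨ *-distribʳ-+ (d u * d v) ⟦ (u Fin.<? v) ×-dec (u ~? v) ⟧ _ ⟨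
      (⟦ (u Fin.<? v) ×-dec (u ~? v) ⟧ + ⟦ (v Fin.<? u) ×-dec (v ~? u) ⟧) * (d u * d v)
        ≡⟨ cong (_* (d u * d v)) (split u v) ⟩
      ⟦ u ~? v ⟧ * (d u * d v) ∎

-- Paths

lookup-injective : {A : Set} {xs : List A} → Unique xs → ∀ {i j} → List.lookup xs i ≡ List.lookup xs j → i ≡ j
lookup-injective (x∉ ∷ _)  {zero}  {zero}  _  = refl
lookup-injective (x∉ ∷ _)  {zero}  {suc j} eq = contradiction eq (All.lookup x∉ (∈-lookup j))
lookup-injective (x∉ ∷ _)  {suc i} {zero}  eq = contradiction (sym eq) (All.lookup x∉ (∈-lookup i))
lookup-injective (_ ∷ xs!) {suc i} {suc j} eq = cong suc (lookup-injective xs! eq)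

Unique⇒length≤ : {xs : List (Fin n)} → Unique xs → length xs ≤ n
Unique⇒length≤ xs! = Fin.injective⇒≤ (lookup-injective xs!)

module _ {A : Set} where
  -- The prefix that ends with the given occurrence of `x`; in `cons-path` it becomes part of a
  -- cycle.
  upTo : {x : A} {xs : List A} → x ∈ xs → List A
  upTo {x} (here _)              = x ∷ []
  upTo {xs = y ∷ _} (there x∈xs) = y ∷ upTo x∈xs

  All-upTo : {P : Pred A 0ℓ} {x : A} {xs : List A} (x∈xs : x ∈ xs) → All P xs → All P (upTo x∈xs)
  All-upTo (here refl)  (px ∷ _)   = px ∷ []
  All-upTo (there x∈xs) (py ∷ pxs) = py ∷ All-upTo x∈xs pxs

  Unique-upTo : {x : A} {xs : List A} (x∈xs : x ∈ xs) → Unique xs → Unique (upTo x∈xs)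
  Unique-upTo (here refl)  (_ ∷ _)    = [] ∷ []
  Unique-upTo (there x∈xs) (y∉ ∷ xs!) = All-upTo x∈xs y∉ ∷ Unique-upTo x∈xs xs!

  Linked-upTo : {R : A → A → Set} {x y z : A} {xs : List A} (x∈xs : x ∈ xs) →
                Linked R (y ∷ xs) → R x z → Linked R (y ∷ upTo x∈xs ∷ʳ z)
  Linked-upTo (here refl)  (y~x ∷ _)  x~z = y~x ∷ x~z ∷ [-]
  Linked-upTo (there x∈xs) (y~x ∷ xs~) x~z = y~x ∷ Linked-upTo x∈xs xs~ x~z

  upTo-nonempty : {x : A} {xs : List A} (x∈xs : x ∈ xs) → 1 ≤ length (upTo x∈xs)
  upTo-nonempty (here _)  = s≤s z≤n
  upTo-nonempty (there _) = s≤s z≤n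

module Paths {n : ℕ} (G : SimpleGraph (Fin n)) (acyclic : Acyclic G) where
  open SimpleGraph G

  private variable
    y y′ z : Fin n
    ys : List (Fin n)

  -- If `z` lay on `ys`, the edge from `z` to `y` would close the stretch of the path from `y` to
  -- `z` into a cycle. Stepping straight back to `y′` is the one repetition that acyclicity does not
  -- forbid, so it is excluded by hypothesis.
  cons-path : IsPath G (y ∷ y′ ∷ ys) → z ~ y → z ≢ y′ → IsPath G (z ∷ y ∷ y′ ∷ ys)
  cons-path {y} {y′} {ys} {z} (linked@(y~y′ ∷ linked′) , unique@(y∉ ∷ unique′)) z~y z≢y′ =
    z~y ∷ linked , (z≢y ∷ z≢y′ ∷ All.¬Any⇒All¬ ys z∉ys) ∷ unique
    where
    z≢y : z ≢ y
    z≢y refl = irrefl refl z~y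

    z∉ys : z ∉ ys
    z∉ys z∈ys = acyclic y (y′ ∷ upTo z∈ys)
      ( s≤s (upTo-nonempty z∈ys)
      , (All-upTo (there z∈ys) y∉ ∷ Unique-upTo (there z∈ys) unique′)
      , y~y′ ∷ Linked-upTo z∈ys linked′ z~y )

  module _ {P Stop : Pred (Fin n) 0ℓ} (Stop? : Decidable Stop)
           (continue : ∀ {y y′} → P y → ¬ Stop y → y ~ y′ → ∃ λ z → P z × z ~ y × z ≢ y′) where

    -- As long as `Stop` fails at the front vertex, `continue` supplies a neighbour other than the
    -- one the path came from, and `cons-path` prepends it. The vertices of a path are distinct, so
    -- this ends within `n` steps.
    extend-path : IsPath G (y ∷ y′ ∷ ys) → P y → ¬ Stop y →
                  ∃₂ λ z pre → IsPath G (z ∷ pre ++ y ∷ y′ ∷ ys) × P z × Stop z × All (¬_ ∘ Stop) pre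
    extend-path = go n (m≤m+n n _)
      where
      go : ∀ fuel → n ≤ fuel + length ys → IsPath G (y ∷ y′ ∷ ys) → P y → ¬ Stop y →
           ∃₂ λ z pre → IsPath G (z ∷ pre ++ y ∷ y′ ∷ ys) × P z × Stop z × All (¬_ ∘ Stop) pre
      -- With no fuel left `ys` alone has at least `n` entries, and the path has two more.
      go zero n≤ path py ¬stop = contradiction (≤-trans (m≤n⇒m≤1+n (s≤s n≤)) (Unique⇒length≤ (proj₂ path))) 1+n≰n
      go {ys} {y} {y′} (suc fuel) n≤ path@(y~y′ ∷ _ , _) py ¬stop
        with z , pz , z~y , z≢y′ ← continue py ¬stop y~y′
        with path′ ← cons-path path z~y z≢y′
        with Stop? z
      ... | yes stop = z , [] , path′ , pz , stop , []
      ... | no ¬stop-z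
        with z′ , pre , path″ , pz′ , stop , ¬stops
             ← go fuel (≤-trans n≤ (≤-reflexive (sym (+-suc fuel (length ys))))) path′ pz ¬stop-z
        = z′ , pre ∷ʳ z
        , subst (λ xs → IsPath G (z′ ∷ xs)) (sym (∷ʳ-++ pre z (y ∷ y′ ∷ ys))) path″
        , pz′ , stop , All.∷ʳ⁺ ¬stops ¬stop-z

-- Forests

module _ {P : Pred (Fin n) 0ℓ} (P? : Decidable P) where
  infixl 6 _without_ _adjoin_
  _without_ : (v : Fin n) → Decidable (λ u → P u × u ≢ v)
  _without_ v u = P? u ×-dec ¬? (u Fin.≟ v)

  _adjoin_ : (v : Fin n) → Decidable (λ u → P u ⊎ u ≡ v)
  _adjoin_ v u = P? u ⊎-dec (u Fin.≟ v)

-- `P` is the disjoint union of `Q` and the single vertex `v`. As an equation between indicators it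
-- serves both the removal and the adjunction of a vertex, and it can be summed directly.
Insertion : {P Q : Pred (Fin n) 0ℓ} → Decidable P → Decidable Q → Fin n → Set
Insertion P? Q? v = ∀ u → ⟦ P? u ⟧ ≡ ⟦ Q? u ⟧ + ⟦ u Fin.≟ v ⟧

module _ {P : Pred (Fin n) 0ℓ} (P? : Decidable P) where

  insertion-without : ∀ {v} → P v → Insertion P? (P? without v) v
  insertion-without {v} pv u with u Fin.≟ v
  ... | no u≢v  = sym (trans (+-identityʳ _) (⟦⟧-⇔ (mk⇔ proj₁ (_, u≢v)) (P? u ×-dec ¬? (no u≢v)) (P? u)))
  ... | yes refl = trans (⟦⟧-yes (P? u) pv) (cong (_+ 1) (sym (⟦⟧-no {A = P u × u ≢ u} (P? u ×-dec ¬? (yes refl)) (λ (_ , u≢u) → u≢u refl))))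

  insertion-adjoin : ∀ {v} → ¬ P v → Insertion (P? adjoin v) P? v
  insertion-adjoin {v} ¬pv u with u Fin.≟ v
  ... | no u≢v   = trans (⟦⟧-⇔ (mk⇔ [ id , (λ u≡v → contradiction u≡v u≢v) ]′ inj₁) (P? u ⊎-dec no u≢v) (P? u))
                         (sym (+-identityʳ _))
  ... | yes refl = trans (⟦⟧-yes {A = P u ⊎ u ≡ u} (P? u ⊎-dec yes refl) (inj₂ refl)) (cong (_+ 1) (sym (⟦⟧-no (P? u) ¬pv)))

  count>0⇒∃ : count P? > 0 → ∃ P
  count>0⇒∃ pos with u , pos-u ← sum>0⇒∃ _ pos with P? u | pos-u
  ... | yes pu | _ = u , pu
  ... | no  _  | ()

  count≡0⇒¬ : count P? ≡ 0 → ∀ {v} → ¬ P v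
  count≡0⇒¬ eq {v} pv = contradiction (trans (sym (⟦⟧-yes (P? v) pv)) (sum≡0⇒≡0 _ eq v)) λ ()

  ∃⇒count>0 : ∀ {v} → P v → count P? > 0
  ∃⇒count>0 pv with count P? in eq
  ... | zero  = contradiction pv (count≡0⇒¬ eq)
  ... | suc _ = z<s

count-insertion : {P Q : Pred (Fin n) 0ℓ} {P? : Decidable P} {Q? : Decidable Q} {v : Fin n} →
                  Insertion P? Q? v → count P? ≡ suc (count Q?)
count-insertion {n} {Q? = Q?} {v} ins = begin
  _                                                      ≡⟨ sum-cong-≗ ins ⟩
  ∑[ u < n ] (⟦ Q? u ⟧ + ⟦ u Fin.≟ v ⟧)                  ≡⟨ ∑-distrib-+ (λ u → ⟦ Q? u ⟧) _ ⟩
  count Q? + ∑[ u < n ] ⟦ u Fin.≟ v ⟧                    ≡⟨ cong (count Q? +_) (sum-cong-≗ λ u → sym (*-identityʳ ⟦ u Fin.≟ v ⟧)) ⟩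
  count Q? + ∑[ u < n ] (⟦ u Fin.≟ v ⟧ * 1)              ≡⟨ cong (count Q? +_) (sum-δ v (λ _ → 1)) ⟩
  count Q? + 1                                           ≡⟨ +-comm (count Q?) 1 ⟩
  suc (count Q?)                                         ∎
  where open ≡-Reasoning

module _ {P : Pred (Fin n) 0ℓ} (P? : Decidable P) where

  count≥2⇒∃≢ : 2 ≤ count P? → ∀ v → ∃ λ u → P u × u ≢ v
  count≥2⇒∃≢ two v with P? v
  ... | yes pv = count>0⇒∃ (P? without v) (s≤s⁻¹ (subst (2 ≤_) (count-insertion {P? = P?} {P? without v} (insertion-without P? pv)) two))
  ... | no ¬pv with u , pu ← count>0⇒∃ P? (≤-trans (s≤s z≤n) two) = u , pu , λ { refl → ¬pv pu }

  ≢⇒count≥2 : ∀ {x y} → P x → P y → x ≢ y → 2 ≤ count P?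
  ≢⇒count≥2 {x} {y} px py x≢y = subst (2 ≤_) (sym (count-insertion {P? = P?} {P? without x} (insertion-without P? px)))
    (s≤s (∃⇒count>0 (P? without x) {y} (py , x≢y ∘ sym)))

  count≤1⇒≡ : count P? ≤ 1 → ∀ {x y} → P x → P y → x ≡ y
  count≤1⇒≡ one {x} {y} px py = decidable-stable (x Fin.≟ y) λ x≢y →
    contradiction (≤-trans (≢⇒count≥2 px py x≢y) one) 1+n≰n

-- Edges inside a set of vertices

module Subsets {n : ℕ} (G : SimpleGraph (Fin n)) where
  open SimpleGraph G
  open Sums G using (~?-sym)

  module _ {S : Pred (Fin n) 0ℓ} (S? : Decidable S) where

    neighbours : Fin n → ℕ
    neighbours v = count (λ u → (v ~? u) ×-dec S? u)

    -- Ordered pairs, so every edge inside S is counted twice.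
    2edges : ℕ
    2edges = ∑[ u < n ] (⟦ S? u ⟧ * neighbours u)

  module _ {P Q : Pred (Fin n) 0ℓ} {P? : Decidable P} {Q? : Decidable Q} {v : Fin n} (ins : Insertion P? Q? v) where

    neighbours-insertion : ∀ u → neighbours P? u ≡ neighbours Q? u + ⟦ v ~? u ⟧
    neighbours-insertion u = begin
      neighbours P? u
        ≡⟨ sum-cong-≗ (λ w → trans (⟦⟧-× (u ~? w) (P? w)) (cong (⟦ u ~? w ⟧ *_) (ins w))) ⟩
      ∑[ w < n ] (⟦ u ~? w ⟧ * (⟦ Q? w ⟧ + ⟦ w Fin.≟ v ⟧))
        ≡⟨ sum-cong-≗ (λ w → expand ⟦ u ~? w ⟧ ⟦ Q? w ⟧ ⟦ w Fin.≟ v ⟧) ⟩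
      ∑[ w < n ] (⟦ u ~? w ⟧ * ⟦ Q? w ⟧ + ⟦ w Fin.≟ v ⟧ * ⟦ u ~? w ⟧)
        ≡⟨ ∑-distrib-+ {n} _ _ ⟩
      ∑[ w < n ] (⟦ u ~? w ⟧ * ⟦ Q? w ⟧) + ∑[ w < n ] (⟦ w Fin.≟ v ⟧ * ⟦ u ~? w ⟧)
        ≡⟨ cong₂ _+_ (sum-cong-≗ λ w → sym (⟦⟧-× (u ~? w) (Q? w)))
                     (trans (sum-δ v (λ w → ⟦ u ~? w ⟧)) (~?-sym u v)) ⟩
      neighbours Q? u + ⟦ v ~? u ⟧ ∎
      where
      open ≡-Reasoning
      expand : ∀ a q e → a * (q + e) ≡ a * q + e * a
      expand = solve-∀

    neighbours-self : neighbours P? v ≡ neighbours Q? v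
    neighbours-self = trans (neighbours-insertion v)
      (trans (cong (neighbours Q? v +_) (⟦⟧-no (v ~? v) (irrefl refl))) (+-identityʳ _))

    -- The new edges are those between `v` and `Q`, each counted in both orders.
    2edges-insertion : 2edges P? ≡ 2edges Q? + 2 * neighbours Q? v
    2edges-insertion = begin
      2edges P?
        ≡⟨ sum-cong-≗ (λ u → trans (cong₂ _*_ (ins u) (neighbours-insertion u))
                                   (expand ⟦ Q? u ⟧ ⟦ u Fin.≟ v ⟧ (neighbours Q? u) ⟦ v ~? u ⟧)) ⟩
      ∑[ u < n ] (⟦ Q? u ⟧ * neighbours Q? u + (⟦ v ~? u ⟧ * ⟦ Q? u ⟧ + ⟦ u Fin.≟ v ⟧ * (neighbours Q? u + ⟦ v ~? u ⟧)))
        ≡⟨ trans (∑-distrib-+ {n} _ _) (cong (2edges Q? +_) (∑-distrib-+ {n} _ _)) ⟩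
      2edges Q? + (∑[ u < n ] (⟦ v ~? u ⟧ * ⟦ Q? u ⟧) + ∑[ u < n ] (⟦ u Fin.≟ v ⟧ * (neighbours Q? u + ⟦ v ~? u ⟧)))
        ≡⟨ cong (2edges Q? +_) (cong₂ _+_ (sum-cong-≗ λ u → sym (⟦⟧-× (v ~? u) (Q? u)))
             (trans (sum-δ v _) (trans (sym (neighbours-insertion v)) neighbours-self))) ⟩
      2edges Q? + (neighbours Q? v + neighbours Q? v)
        ≡⟨ cong (λ x → 2edges Q? + (neighbours Q? v + x)) (+-identityʳ _) ⟨
      2edges Q? + 2 * neighbours Q? v ∎
      where
      open ≡-Reasoning
      expand : ∀ q e m a → (q + e) * (m + a) ≡ q * m + (a * q + e * (m + a))
      expand = solve-∀

module Forest {n : ℕ} (G : SimpleGraph (Fin n)) (acyclic : Acyclic G) where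
  open SimpleGraph G
  open Subsets G
  open Paths G acyclic

  -- Every step of the walk has to end in `S`; its starting point lies in `S` by hypothesis.
  ConnectedIn : Pred (Fin n) 0ℓ → Set
  ConnectedIn S = ∀ {x y} → S x → S y → Star (λ u v → S v × u ~ v) x y

  module _ {S : Pred (Fin n) 0ℓ} (S? : Decidable S) where

    -- #edges + 1 ≡ #vertices inside S, doubled.
    Tight : Set
    Tight = 2edges S? + 2 ≡ 2 * count S?

    abstract
      -- A path in S is prolonged until it reaches such a vertex.
      leaf : ∃ S → ∃ λ v → S v × neighbours S? v ≤ 1
      leaf (v , sv) with neighbours S? v ≤? 1
      ... | yes ≤1 = v , sv , ≤1
      ... | no ≰1 with y , v~y , sy ← count>0⇒∃ (λ u → (v ~? u) ×-dec S? u) (≤-trans (s≤s z≤n) (≰⇒> ≰1))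
          with z , _ , _ , sz , ≤1 , _ ← extend-path {P = S} {λ u → neighbours S? u ≤ 1} (λ u → neighbours S? u ≤? 1)
                 (λ {u} {u′} su ≰1 _ → let w , (u~w , sw) , w≢u′ = count≥2⇒∃≢ (λ w → (u ~? w) ×-dec S? w) (≰⇒> ≰1) u′
                                       in w , sw , ~-sym u~w , w≢u′)
                 (v~y ∷ [-] , ((λ v≡y → irrefl v≡y v~y) ∷ []) ∷ [] ∷ []) sv ≰1
          = z , sz , ≤1

    neighbours-empty : count S? ≡ 0 → ∀ v → neighbours S? v ≡ 0
    neighbours-empty eq v = ≡0⇒sum≡0 {n} _ λ u → ⟦⟧-no ((v ~? u) ×-dec S? u) (count≡0⇒¬ S? eq ∘ proj₂)

    2edges-empty : count S? ≡ 0 → 2edges S? ≡ 0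
    2edges-empty eq = ≡0⇒sum≡0 {n} _ λ u → cong (_* neighbours S? u) (⟦⟧-no (S? u) (count≡0⇒¬ S? eq))

    module Prune (nonempty : ∃ S) where
      v : Fin n
      v = proj₁ (leaf nonempty)

      sv : S v
      sv = proj₁ (proj₂ (leaf nonempty))

      S′ : Pred (Fin n) 0ℓ
      S′ u = S u × u ≢ v

      S′? : Decidable S′
      S′? = S? without v

      private
        insertion : Insertion S? S′? v
        insertion = insertion-without S? sv

      count-prune : count S? ≡ suc (count S′?)
      count-prune = count-insertion {P? = S?} {S′?} insertion

      2edges-prune : 2edges S? ≡ 2edges S′? + 2 * neighbours S′? v
      2edges-prune = 2edges-insertion {P? = S?} {S′?} insertion

      neighbours≤1 : neighbours S′? v ≤ 1
      neighbours≤1 = subst (_≤ 1) (neighbours-self {P? = S?} {S′?} insertion) (proj₂ (proj₂ (leaf nonempty)))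

      sole-neighbour : ∀ {x z} → S x → S z → v ~ x → v ~ z → x ≡ z
      sole-neighbour sx sz v~x v~z =
        count≤1⇒≡ (λ u → (v ~? u) ×-dec S? u) (proj₂ (proj₂ (leaf nonempty))) (v~x , sx) (v~z , sz)

      -- A walk that visits the leaf v comes back to the vertex it left.
      prune-walk : ∀ {x y} → S x → x ≢ v → y ≢ v → Star (λ u w → S w × u ~ w) x y → Star (λ u w → S′ w × u ~ w) x y
      prune-walk sx x≢v y≢v ε = ε
      prune-walk {x} sx x≢v y≢v (_◅_ {j = z} (sz , x~z) walk) with z Fin.≟ v
      ... | no z≢v = ((sz , z≢v) , x~z) ◅ prune-walk sz z≢v y≢v walk
      prune-walk sx x≢v y≢v (_ ◅ ε) | yes refl = contradiction refl y≢v
      prune-walk sx x≢v y≢v ((sv , x~v) ◅ (sz , v~z) ◅ walk) | yes refl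
        with refl ← sole-neighbour sx sz (~-sym x~v) v~z = prune-walk sx x≢v y≢v walk

  count≡suc⇒∃ : {S : Pred (Fin n) 0ℓ} (S? : Decidable S) → ∀ {k} → count S? ≡ suc k → ∃ S
  count≡suc⇒∃ S? eq = count>0⇒∃ S? (subst (_> 0) (sym eq) z<s)

  private
    -- Induction on the number of vertices: pruning a leaf removes one vertex and at most one edge.
    forest-bound′ : ∀ k {S : Pred (Fin n) 0ℓ} (S? : Decidable S) → count S? ≡ suc k → 2edges S? + 2 ≤ 2 * suc k
    forest-bound′ zero S? eq = ≤-reflexive (trans (cong (_+ 2) 2edges-prune) (cong (_+ 2) (cong₂ (λ a b → a + 2 * b)
        (2edges-empty S′? empty) (neighbours-empty S′? empty v))))
      where
      open Prune S? (count≡suc⇒∃ S? eq)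
      empty : count S′? ≡ 0
      empty = suc-injective (trans (sym count-prune) eq)
    forest-bound′ (suc k) S? eq = begin
      2edges S? + 2                                ≡⟨ cong (_+ 2) 2edges-prune ⟩
      2edges S′? + 2 * neighbours S′? v + 2        ≡⟨ swap (2edges S′?) (neighbours S′? v) ⟩
      2edges S′? + 2 + 2 * neighbours S′? v        ≤⟨ +-mono-≤ (forest-bound′ k S′? (suc-injective (trans (sym count-prune) eq)))
                                                               (*-monoʳ-≤ 2 neighbours≤1) ⟩
      2 * suc k + 2                                ≡⟨ +-comm (2 * suc k) 2 ⟩
      2 + 2 * suc k                                ≡⟨ *-suc 2 (suc k) ⟨
      2 * suc (suc k)                              ∎
      where
      open Prune S? (count≡suc⇒∃ S? eq)
      open ≤-Reasoning
      swap : ∀ e m → e + 2 * m + 2 ≡ e + 2 + 2 * m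
      swap = solve-∀

  forest-bound : {S : Pred (Fin n) 0ℓ} (S? : Decidable S) → ∃ S → 2edges S? + 2 ≤ 2 * count S?
  forest-bound S? (_ , sv) with count S? in eq | ∃⇒count>0 S? sv
  ... | suc k | _ = forest-bound′ k S? eq

  private
    cancel : ∀ {e c} → e + 2 * 1 + 2 ≡ 2 * suc c → e + 2 ≡ 2 * c
    cancel {e} {c} eq = +-cancelʳ-≡ 2 (e + 2) (2 * c) (trans eq (trans (*-suc 2 c) (+-comm 2 (2 * c))))

    slack : ∀ {e c} → e + 2 ≤ 2 * c → e + 2 * 0 + 2 ≢ 2 * suc c
    slack {e} {c} bound eq = <⇒≢ (begin-strict
      e + 0 + 2   ≡⟨ cong (_+ 2) (+-identityʳ e) ⟩
      e + 2       ≤⟨ bound ⟩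
      2 * c       <⟨ *-monoʳ-< 2 (n<1+n c) ⟩
      2 * suc c   ∎) eq
      where open ≤-Reasoning

    -- Here `e` and `c` belong to the pruned set and `m` counts the neighbours of the removed leaf.
    -- With `m` equal to 0 the pruned set would exceed its own bound.
    tight⇒1 : ∀ {e c m} → m ≤ 1 → e + 2 ≤ 2 * c → e + 2 * m + 2 ≡ 2 * suc c → m ≡ 1
    tight⇒1 {e} {c} {zero}    _        bound eq = contradiction eq (slack {e} {c} bound)
    tight⇒1 {m = suc zero}    _        _     _  = refl
    tight⇒1 {m = suc (suc _)} (s≤s ()) _     _

    -- Equality in the bound forces the pruned leaf to have exactly one neighbour and leaves
    -- equality for the pruned set. That set is connected by induction, and the leaf hangs on it by
    -- one edge.
    tight⇒connected′ : ∀ k {S : Pred (Fin n) 0ℓ} (S? : Decidable S) → count S? ≡ suc k → Tight S? → ConnectedIn S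
    tight⇒connected′ zero {S} S? eq tight sx sy = all-equal (trans (≡v sx) (sym (≡v sy)))
      where
      open Prune S? (count≡suc⇒∃ S? eq)
      all-equal : ∀ {x y} → x ≡ y → Star (λ u w → S w × u ~ w) x y
      all-equal refl = ε
      ≡v : ∀ {x} → S x → x ≡ v
      ≡v {x} sx = decidable-stable (x Fin.≟ v) λ x≢v →
        count≡0⇒¬ S′? (suc-injective (trans (sym count-prune) eq)) (sx , x≢v)
    tight⇒connected′ (suc k) {S} S? eq tight = λ sx sy → to-v stem sx ◅◅ from-v stem sy
      where
      open Prune S? (count≡suc⇒∃ S? eq)
      eq′ : count S′? ≡ suc k
      eq′ = suc-injective (trans (sym count-prune) eq)
      tight+ : 2edges S′? + 2 * neighbours S′? v + 2 ≡ 2 * suc (count S′?)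
      tight+ = trans (cong (_+ 2) (sym 2edges-prune)) (trans tight (cong (2 *_) count-prune))
      neighbours≡1 : neighbours S′? v ≡ 1
      neighbours≡1 = tight⇒1 {2edges S′?} {count S′?} {neighbours S′? v} neighbours≤1 (forest-bound S′? (count≡suc⇒∃ S′? eq′)) tight+
      tight′ : Tight S′?
      tight′ = cancel {2edges S′?} {count S′?} (subst (λ m → 2edges S′? + 2 * m + 2 ≡ 2 * suc (count S′?)) neighbours≡1 tight+)
      connected′ : ConnectedIn S′
      connected′ = tight⇒connected′ k S′? eq′ tight′
      weaken : ∀ {x y} → Star (λ u w → S′ w × u ~ w) x y → Star (λ u w → S w × u ~ w) x y
      weaken = Star.map (Product.map₁ proj₁)
      Stem : Set
      Stem = ∃ λ w → v ~ w × S′ w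
      to-v : Stem → ∀ {x} → S x → Star (λ u w → S w × u ~ w) x v
      to-v (w , v~w , sw) {x} sx with x Fin.≟ v
      ... | yes refl = ε
      ... | no x≢v   = weaken (connected′ (sx , x≢v) sw) ◅◅ ((sv , ~-sym v~w) ◅ ε)
      from-v : Stem → ∀ {x} → S x → Star (λ u w → S w × u ~ w) v x
      from-v (w , v~w , sw) {x} sx with x Fin.≟ v
      ... | yes refl = ε
      ... | no x≢v   = (proj₁ sw , v~w) ◅ weaken (connected′ sw (sx , x≢v))
      stem : Stem
      stem = count>0⇒∃ (λ u → (v ~? u) ×-dec S′? u) (≤-reflexive (sym neighbours≡1))

    -- A connected set stays connected when a leaf is pruned. The leaf has a neighbour because a
    -- walk leads from it to another vertex, so exactly one edge is lost with it.
    connected⇒tight′ : ∀ k {S : Pred (Fin n) 0ℓ} (S? : Decidable S) → count S? ≡ suc k → ConnectedIn S → Tight S?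
    connected⇒tight′ zero S? eq connected = trans (trans (cong (_+ 2) 2edges-prune) (cong (_+ 2) (cong₂ (λ a b → a + 2 * b)
        (2edges-empty S′? empty) (neighbours-empty S′? empty v)))) (cong (2 *_) (sym eq))
      where
      open Prune S? (count≡suc⇒∃ S? eq)
      empty : count S′? ≡ 0
      empty = suc-injective (trans (sym count-prune) eq)
    connected⇒tight′ (suc k) {S} S? eq connected = begin
      2edges S? + 2                                ≡⟨ cong (_+ 2) 2edges-prune ⟩
      2edges S′? + 2 * neighbours S′? v + 2        ≡⟨ cong (λ x → 2edges S′? + 2 * x + 2) (≤-antisym neighbours≤1 neighbours≥1) ⟩
      2edges S′? + 2 + 2                           ≡⟨ cong (_+ 2) (connected⇒tight′ k S′? eq′ λ (sx , x≢v) (sy , y≢v) →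
                                                        prune-walk sx x≢v y≢v (connected sx sy)) ⟩
      2 * count S′? + 2                            ≡⟨ +-comm (2 * count S′?) 2 ⟩
      2 + 2 * count S′?                            ≡⟨ *-suc 2 (count S′?) ⟨
      2 * suc (count S′?)                          ≡⟨ cong (2 *_) count-prune ⟨
      2 * count S?                                 ∎
      where
      open Prune S? (count≡suc⇒∃ S? eq)
      open ≡-Reasoning
      eq′ : count S′? ≡ suc k
      eq′ = suc-injective (trans (sym count-prune) eq)
      first-step : ∀ {y} → y ≢ v → Star (λ u w → S w × u ~ w) v y → ∃ λ w → S w × v ~ w
      first-step y≢v ε = contradiction refl y≢v
      first-step _ (step ◅ _) = _ , step
      neighbours≥1 : neighbours S′? v ≥ 1
      neighbours≥1 with y , sy , y≢v ← count≡suc⇒∃ S′? eq′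
        with w , sw , v~w ← first-step y≢v (connected sv sy)
        = ∃⇒count>0 (λ u → (v ~? u) ×-dec S′? u) {w} (v~w , sw , λ w≡v → irrefl (sym w≡v) v~w)

  tight⇒connected : {S : Pred (Fin n) 0ℓ} (S? : Decidable S) → Tight S? → ConnectedIn S
  tight⇒connected S? tight with count S? in eq
  ... | zero  = λ sx → contradiction sx (count≡0⇒¬ S? eq)
  ... | suc k = tight⇒connected′ k S? eq (trans tight (cong (2 *_) (sym eq)))

  connected⇒tight : {S : Pred (Fin n) 0ℓ} (S? : Decidable S) → ∃ S → ConnectedIn S → Tight S?
  connected⇒tight S? (_ , sv) connected with count S? in eq | ∃⇒count>0 S? sv
  ... | suc k | _ = trans (connected⇒tight′ k S? eq connected) (cong (2 *_) eq)

  -- The forest bound applies to `S` together with `v`. Since `S` already attains it, one more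
  -- vertex leaves room for only one more edge.
  tight⇒neighbours≤1 : {S : Pred (Fin n) 0ℓ} (S? : Decidable S) → Tight S? → ∀ {v} → ¬ S v → neighbours S? v ≤ 1
  tight⇒neighbours≤1 {S} S? tight {v} ¬sv = *-cancelˡ-≤ 2 (+-cancelˡ-≤ (2edges S? + 2) _ _ (begin
    2edges S? + 2 + 2 * neighbours S? v      ≡⟨ swap (2edges S?) (neighbours S? v) ⟩
    2edges S? + 2 * neighbours S? v + 2      ≡⟨ cong (_+ 2) (2edges-insertion {P? = S? adjoin v} {S?} insertion) ⟨
    2edges (S? adjoin v) + 2                 ≤⟨ forest-bound (S? adjoin v) (v , inj₂ refl) ⟩
    2 * count (S? adjoin v)                  ≡⟨ cong (2 *_) (count-insertion {P? = S? adjoin v} {S?} insertion) ⟩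
    2 * suc (count S?)                       ≡⟨ trans (*-suc 2 (count S?)) (+-comm 2 (2 * count S?)) ⟩
    2 * count S? + 2                         ≡⟨ cong (_+ 2) tight ⟨
    2edges S? + 2 + 2                        ∎))
    where
    open ≤-Reasoning
    insertion : Insertion (S? adjoin v) S? v
    insertion = insertion-adjoin S? ¬sv
    swap : ∀ e m → e + 2 + 2 * m ≡ e + 2 * m + 2
    swap = solve-∀

  -- An outside vertex with a neighbour in `S` has exactly one, so one vertex and one edge are
  -- added.
  tight-adjoin : {S : Pred (Fin n) 0ℓ} (S? : Decidable S) → Tight S? → ∀ {u v} → S u → v ~ u → ¬ S v → Tight (S? adjoin v)
  tight-adjoin S? tight {u} {v} su v~u ¬sv = begin
    2edges (S? adjoin v) + 2                 ≡⟨ cong (_+ 2) (2edges-insertion {P? = S? adjoin v} {S?} insertion) ⟩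
    2edges S? + 2 * neighbours S? v + 2      ≡⟨ cong (λ x → 2edges S? + 2 * x + 2) (≤-antisym (tight⇒neighbours≤1 S? tight ¬sv)
                                                  (∃⇒count>0 (λ w → (v ~? w) ×-dec S? w) {u} (v~u , su))) ⟩
    2edges S? + 2 + 2                        ≡⟨ cong (_+ 2) tight ⟩
    2 * count S? + 2                         ≡⟨ trans (*-suc 2 (count S?)) (+-comm 2 (2 * count S?)) ⟨
    2 * suc (count S?)                       ≡⟨ cong (2 *_) (count-insertion {P? = S? adjoin v} {S?} insertion) ⟨
    2 * count (S? adjoin v)                  ∎
    where
    open ≡-Reasoning
    insertion = insertion-adjoin S? ¬sv

  -- The inner vertices are adjoined to `S` one after the other, which keeps the set tight. The last
  -- of them would be an outside vertex with two neighbours in a tight set.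
  no-ear : ∀ us {S : Pred (Fin n) 0ℓ} (S? : Decidable S) → Tight S? → ∀ {u w} → S u → S w →
           IsPath G (u ∷ us ∷ʳ w) → All (¬_ ∘ S) us → us ≡ []
  no-ear [] S? tight su sw path out = refl
  no-ear (x ∷ []) S? tight {u} {w} su sw (u~x ∷ x~w ∷ [-] , (_ ∷ u≢w ∷ []) ∷ _) (¬sx ∷ []) =
    contradiction (≤-trans (≢⇒count≥2 (λ y → (x ~? y) ×-dec S? y) (~-sym u~x , su) (x~w , sw) u≢w)
                           (tight⇒neighbours≤1 S? tight ¬sx)) 1+n≰n
  no-ear (x ∷ us@(_ ∷ _)) S? tight su sw (u~x ∷ linked , _ ∷ unique@(x∉ ∷ _)) (¬sx ∷ out)
    -- The shorter path from `x` to `w` is an ear on the enlarged set, so the recursive call claims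
    -- that the nonempty list `us` is empty.
    with () ← no-ear us (S? adjoin x) (tight-adjoin S? tight su (~-sym u~x) ¬sx) (inj₂ refl) (inj₁ sw) (linked , unique)
                (All.zipWith (λ { (¬s , x≢) → [ ¬s , x≢ ∘ sym ]′ }) (out , proj₁ (All.∷ʳ⁻ x∉)))

-- The four bounds

is : ℕ → ℕ → ℕ
is k i = ⟦ i ≟ k ⟧

br : ℕ → ℕ
br i = ⟦ 2 <? i ⟧

VertexTable : (g h : ℕ → ℕ) → Set
VertexTable g h = ∀ (k : Fin 4) → let i = suc (toℕ k) in g i ≡ h i

vertexTable? : ∀ g h → Dec (VertexTable g h)
vertexTable? g h = Fin.all? λ k → g (suc (toℕ k)) ≟ h (suc (toℕ k))

-- No edge of a tree with a branching vertex joins two pendent vertices.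
EdgeTable : (f g : ℕ → ℕ → ℕ) → Set
EdgeTable f g = ∀ (k l : Fin 4) → let i = suc (toℕ k); j = suc (toℕ l) in 2 < i + j → f i j ≡ g i j

edgeTable? : ∀ f g → Dec (EdgeTable f g)
edgeTable? f g = Fin.all? λ k → Fin.all? λ l → let i = suc (toℕ k); j = suc (toℕ l) in
  (2 <? i + j) →-dec (f i j ≟ g i j)

weights : ℕ → ℕ → ℕ → ℕ → ℕ → ℕ
weights a b c d 1 = a
weights a b c d 2 = b
weights a b c d 3 = c
weights a b c d 4 = d
weights a b c d _ = 0

-- A dual certificate: ρ i j is the loss at an edge between degrees i and j, α and β price
-- the bounds on the numbers of edges inside the branching vertices and inside the
-- vertices of degree 4, and h splits what is left between the two ends.  The summand 2
-- at every edge, balanced by 2 * i at every vertex, keeps h non-negative.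
edgeˡ : (ρ : ℕ → ℕ → ℕ) → ℕ → ℕ → ℕ
edgeˡ ρ i j = i * j + ρ i j + 2

edgeʳ : (α β : ℕ) (h : ℕ → ℕ) → ℕ → ℕ → ℕ
edgeʳ α β h i j = h i + h j + (α * (br i * br j) + β * (is 4 i * is 4 j))

vertexˡ : (α β c : ℕ) (h g : ℕ → ℕ) → ℕ → ℕ
vertexˡ α β c h g i = 2 * (i * h i) + g i + (α * (2 * br i) + β * (2 * is 4 i)) + c * 2

vertexʳ : (c : ℕ) (g : ℕ → ℕ) → ℕ → ℕ
vertexʳ c g i = g i + (c + 2) * i

-- Adds up equations; what remains after the last one is an identity of semirings.
combine : ∀ {a b} l r → a ≡ b → l + b ≡ r + a → l ≡ r
combine l r refl eq = +-cancelʳ-≡ _ l r eq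

-- Degrees in a chemical tree and the deficit identity

module Chemical {n b : ℕ} (G : SimpleGraph (Fin n)) (1≤b : 1 ≤ b) (ct* : CT* G b) where
  open SimpleGraph G
  open Sums G
  open Subsets G

  connected : Connected G
  connected = proj₁ (proj₁ (proj₁ ct*))

  acyclic : Acyclic G
  acyclic = proj₂ (proj₁ (proj₁ ct*))

  d≤4 : ∀ v → d v ≤ 4
  d≤4 = proj₂ (proj₁ ct*)

  open Forest G acyclic

  Br? : Decidable (Branching G)
  Br? v = 2 <? d v

  Four? : Decidable (λ v → d v ≡ 4)
  Four? v = d v ≟ 4

  b≡V : V br ≡ b
  b≡V = trans (sym #branching≡V) (proj₂ ct*)

  ∃branching : ∃ (Branching G)
  ∃branching = count>0⇒∃ Br? (subst (1 ≤_) (sym b≡V) 1≤b)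

  neighbour⇒d>0 : ∀ {u v} → u ~ v → d u > 0
  neighbour⇒d>0 {u} u~v = subst (_> 0) (sym (degree≡count u)) (∃⇒count>0 (u ~?_) u~v)

  d>0 : ∀ v → d v > 0
  d>0 v with proj₁ ∃branching | proj₂ ∃branching | connected v (proj₁ ∃branching)
  ... | _ | 2<d | ε         = ≤-trans (s≤s z≤n) 2<d
  ... | _ | _   | v~w ◅ _   = neighbour⇒d>0 v~w

  pendent-unique : ∀ {u v w} → d u ≡ 1 → u ~ v → u ~ w → v ≡ w
  pendent-unique {u} du≡1 = count≤1⇒≡ (u ~?_) (≤-reflexive (trans (sym (degree≡count u)) du≡1))

  -- Two adjacent pendent vertices form a whole component, yet a walk leads from them to a branching
  -- vertex.
  pendents-nonadjacent : ∀ {u v} → u ~ v → d u ≡ 1 → d v ≢ 1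
  pendents-nonadjacent {u} {v} u~v du≡1 dv≡1 = [ absurd du≡1 , absurd dv≡1 ]′
      (reach (inj₁ refl) (connected u (proj₁ ∃branching)))
    where
    reach : ∀ {x y} → x ≡ u ⊎ x ≡ v → Star _~_ x y → y ≡ u ⊎ y ≡ v
    reach at ε = at
    reach (inj₁ refl) (u~w ◅ walk) = reach (inj₂ (pendent-unique du≡1 u~w u~v)) walk
    reach (inj₂ refl) (v~w ◅ walk) = reach (inj₁ (pendent-unique dv≡1 v~w (~-sym u~v))) walk
    absurd : ∀ {x} → d x ≡ 1 → proj₁ ∃branching ≢ x
    absurd dx≡1 refl = contradiction (subst (2 <_) dx≡1 (proj₂ ∃branching)) λ { (s≤s ()) }

  degree-index : ∀ v → ∃ λ (k : Fin 4) → d v ≡ suc (toℕ k)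
  degree-index v with d v | d>0 v | d≤4 v
  ... | suc i | _ | s≤s i≤3 = Fin.fromℕ< (s≤s i≤3) , cong suc (sym (Fin.toℕ-fromℕ< (s≤s i≤3)))

  degree-sum>2 : ∀ {u v} → u ~ v → 2 < d u + d v
  degree-sum>2 {u} {v} u~v with d u in du | d v in dv | d>0 u | d>0 v
  ... | suc zero    | suc zero    | _ | _ = contradiction dv (pendents-nonadjacent u~v du)
  ... | suc zero    | suc (suc _) | _ | _ = s≤s (s≤s (s≤s z≤n))
  ... | suc (suc i) | suc j       | _ | _ = s≤s (s≤s (≤-trans (s≤s z≤n) (m≤n+m (suc j) i)))

  -- Only the degrees 1 to 4 occur, so an equation between functions of the degree follows from a
  -- finite table, which can be checked by evaluation.
  at-vertex : ∀ {g h} → VertexTable g h → ∀ v → g (d v) ≡ h (d v)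
  at-vertex {g} {h} table v with k , eq ← degree-index v = subst (λ i → g i ≡ h i) (sym eq) (table k)

  at-edge : ∀ {f g} → EdgeTable f g → ∀ {u v} → u ~ v → f (d u) (d v) ≡ g (d u) (d v)
  at-edge {f} {g} table {u} {v} u~v with k , du ← degree-index u with l , dv ← degree-index v =
    subst₂ (λ i j → f i j ≡ g i j) (sym du) (sym dv)
      (table k l (subst₂ (λ i j → 2 < i + j) du dv (degree-sum>2 u~v)))

  V1≡n : V (λ _ → 1) ≡ n
  V1≡n = sum-ones n
    where
    sum-ones : ∀ m → ∑[ i < m ] 1 ≡ m
    sum-ones zero    = refl
    sum-ones (suc m) = cong suc (sum-ones m)

  -- The set of all vertices is connected, hence tight, and its `2edges` is the degree sum.
  handshake : V id + 2 ≡ 2 * n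
  handshake = begin
    V id + 2              ≡⟨ cong (_+ 2) (sum-cong-≗ λ v → trans (degree≡count v) (trans (sum-cong-≗ λ u →
                               sym (trans (⟦⟧-× (v ~? u) (U? u)) (*-identityʳ _))) (sym (*-identityˡ _)))) ⟩
    2edges all? + 2       ≡⟨ connected⇒tight all? (proj₁ ∃branching , tt) (λ {x} {y} _ _ → Star.map (tt ,_) (connected x y)) ⟩
    2 * count all?        ≡⟨ cong (2 *_) V1≡n ⟩
    2 * n                 ∎
    where
    open ≡-Reasoning
    all? : Decidable {A = Fin n} U
    all? = U?

  2edges≡E : {Q : Pred ℕ 0ℓ} (Q? : Decidable Q) → 2edges (λ v → Q? (d v)) ≡ E (λ i j → ⟦ Q? i ⟧ * ⟦ Q? j ⟧)
  2edges≡E Q? = sum-cong-≗ λ u → trans (*-distribˡ-sum {n} ⟦ Q? (d u) ⟧ _) (sum-cong-≗ λ v →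
    trans (cong (⟦ Q? (d u) ⟧ *_) (⟦⟧-× (u ~? v) (Q? (d v)))) (x∙yz≈y∙xz ⟦ Q? (d u) ⟧ ⟦ u ~? v ⟧ ⟦ Q? (d v) ⟧))

  module _ (α β c : ℕ) (ρ : ℕ → ℕ → ℕ) (h gˡ gʳ : ℕ → ℕ)
    (edge-table : EdgeTable (edgeˡ ρ) (edgeʳ α β h))
    (vertex-table : VertexTable (vertexˡ α β c h gˡ) (vertexʳ c gʳ))
    {S T : ℕ} (S-def : 2 * V br ≡ 2edges Br? + S) (T-def : 2 * V (is 4) ≡ 2edges Four? + T) where

    private
      ends ends+gˡ cut : ℕ → ℕ
      ends i = 2 * (i * h i)
      ends+gˡ i = ends i + gˡ i
      cut i = α * (2 * br i) + β * (2 * is 4 i)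

      bb ff : ℕ → ℕ → ℕ
      bb i j = br i * br j
      ff i j = is 4 i * is 4 j

      edge-sum : 2 * M₂ G + E ρ + 2 * V id ≡ V ends + (α * 2edges Br? + β * 2edges Four?)
      edge-sum = begin
        2 * M₂ G + E ρ + 2 * V id
          ≡⟨ cong₂ _+_ (trans (cong (_+ E ρ) 2M₂≡E) (sym (E-+ _*_ ρ)))
                       (sym (trans (E-tail (λ _ → 2)) (trans (V-cong {λ i → i * 2} {λ i → 2 * i} λ v → *-comm (d v) 2) (V-* 2 id)))) ⟩
        E (λ i j → i * j + ρ i j) + E (λ _ _ → 2)
          ≡⟨ E-+ (λ i j → i * j + ρ i j) (λ _ _ → 2) ⟨
        E (λ i j → i * j + ρ i j + 2)
          ≡⟨ E-cong {edgeˡ ρ} {edgeʳ α β h} (at-edge {edgeˡ ρ} {edgeʳ α β h} edge-table) ⟩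
        E (λ i j → h i + h j + (α * bb i j + β * ff i j))
          ≡⟨ E-+ (λ i j → h i + h j) (λ i j → α * bb i j + β * ff i j) ⟩
        E (λ i j → h i + h j) + E (λ i j → α * bb i j + β * ff i j)
          ≡⟨ cong₂ _+_ (E-ends h) (E-+ (λ i j → α * bb i j) (λ i j → β * ff i j)) ⟩
        V ends + (E (λ i j → α * bb i j) + E (λ i j → β * ff i j))
          ≡⟨ cong (V ends +_) (cong₂ _+_ (E-* α bb) (E-* β ff)) ⟩
        V ends + (α * E bb + β * E ff)
          ≡⟨ cong (V ends +_) (cong₂ (λ x y → α * x + β * y) (2edges≡E (2 <?_)) (2edges≡E (_≟ 4))) ⟨
        V ends + (α * 2edges Br? + β * 2edges Four?) ∎
        where open ≡-Reasoning

      vertex-sum : V ends + V gˡ + (α * (2 * V br) + β * (2 * V (is 4))) + c * (2 * n) ≡ V gʳ + (c + 2) * V id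
      vertex-sum = begin
        V ends + V gˡ + (α * (2 * V br) + β * (2 * V (is 4))) + c * (2 * n)
          ≡⟨ cong₂ _+_ (cong₂ _+_ (V-+ ends gˡ) (trans (V-+ (λ i → α * (2 * br i)) (λ i → β * (2 * is 4 i)))
               (cong₂ _+_ (trans (V-* α (λ i → 2 * br i)) (cong (α *_) (V-* 2 br)))
                          (trans (V-* β (λ i → 2 * is 4 i)) (cong (β *_) (V-* 2 (is 4)))))))
               (trans (V-* c (λ _ → 2)) (cong (c *_) (trans (V-* 2 (λ _ → 1)) (cong (2 *_) V1≡n)))) ⟨
        V ends+gˡ + V cut + V (λ _ → c * 2)
          ≡⟨ trans (V-+ (λ i → ends+gˡ i + cut i) (λ _ → c * 2)) (cong (_+ V (λ _ → c * 2)) (V-+ ends+gˡ cut)) ⟨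
        V (λ i → ends+gˡ i + cut i + c * 2)
          ≡⟨ V-cong {vertexˡ α β c h gˡ} {vertexʳ c gʳ} (at-vertex {vertexˡ α β c h gˡ} {vertexʳ c gʳ} vertex-table) ⟩
        V (λ i → gʳ i + (c + 2) * i)
          ≡⟨ trans (V-+ gʳ (λ i → (c + 2) * i)) (cong (V gʳ +_) (V-* (c + 2) id)) ⟩
        V gʳ + (c + 2) * V id ∎
        where open ≡-Reasoning

    -- The edge table summed over ordered edges and the vertex table summed over vertices share the
    -- term `V ends`, which cancels. The definitions of `S` and `T` replace the inner edge counts,
    -- and `c` copies of the handshake identity remove the rest of the degree sum.
    deficit-identity : 2 * M₂ G + (E ρ + V gˡ + α * S + β * T) + c * 2 ≡ V gʳ
    deficit-identity =
      combine _ _ edge-sum (combine _ _ vertex-sum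
        (combine _ _ (cong (α *_) (sym S-def)) (combine _ _ (cong (β *_) (sym T-def)) (combine _ _ (cong (c *_) handshake)
          (identity (M₂ G) (E ρ) (V gˡ) (V gʳ) (V id) (V ends) (2edges Br?) (2edges Four?) S T (V br) (V (is 4)) n α β c)))))
      where
      identity : ∀ m r gl gr w vh eb ef S T vb vf n α β c →
        2 * m + (r + gl + α * S + β * T) + c * 2 + (vh + (α * eb + β * ef)) + (gr + (c + 2) * w) + α * (2 * vb) + β * (2 * vf) + c * (2 * n)
        ≡ gr + (2 * m + r + 2 * w) + (vh + gl + (α * (2 * vb) + β * (2 * vf)) + c * (2 * n)) + α * (eb + S) + β * (ef + T) + c * (w + 2)
      identity = solve-∀

halve : ∀ a r D → 2 * a + D ≡ 2 * r → a ≤ r × (a ≡ r ⇔ D ≡ 0)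
halve a r D eq = *-cancelˡ-≤ 2 (≤-trans (m≤m+n (2 * a) D) (≤-reflexive eq)) , mk⇔
  (λ { refl → +-cancelˡ-≡ (2 * a) D 0 (trans eq (sym (+-identityʳ (2 * a)))) })
  (λ { refl → *-cancelˡ-≡ a r 2 (trans (sym (+-identityʳ (2 * a))) eq) })

private
  attain-eq₁ : ∀ m q c α β ρ y s t →
              2 * (m + (q + (c + (α + β)))) + (ρ + y + α * s + β * t)
              ≡ 2 * m + (ρ + (y + 2 * q) + α * (2 + s) + β * (2 + t)) + c * 2
  attain-eq₁ = solve-∀

  attain-eq₂ : ∀ m q c α β ρ y′ s T →
              2 * (m + (q + (c + (α + β)))) + suc (ρ + y′ + α * s + β * T)
              ≡ 2 * m + (ρ + (suc (2 * β) + y′ + 2 * q) + α * (2 + s) + β * T) + c * 2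
  attain-eq₂ = solve-∀

-- S and T stand for 2 plus twice the numbers of edges by which the two vertex sets fail to
-- induce trees.  Without vertices of degree 4 that number is -1, which y then outweighs.
attain : ∀ m r q c α β ρ y {S T} → 1 ≤ β → 2 ≤ S → (2 ≤ T ⊎ 2 * β < y) → (y ≡ 0 → T ≡ 2 → S ≡ 2) →
         2 * m + (ρ + (y + 2 * q) + α * S + β * T) + c * 2 ≡ 2 * r →
         m + (q + (c + (α + β))) ≤ r × (m + (q + (c + (α + β))) ≡ r ⇔ (ρ ≡ 0 × y ≡ 0 × T ≡ 2))
attain m r q c α β ρ y {suc (suc s)} {suc (suc t)} 1≤β _ (inj₁ _) S≡2 eq
  with le , equiv ← halve (m + (q + (c + (α + β)))) r (ρ + y + α * s + β * t) (trans (attain-eq₁ m q c α β ρ y s t) eq) =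
  le , mk⇔
    (λ attained → let D≡0 = Equivalence.to equiv attained
                      D′≡0 = m+n≡0⇒m≡0 (ρ + y + α * s) D≡0
                      D″≡0 = m+n≡0⇒m≡0 (ρ + y) D′≡0
                  in m+n≡0⇒m≡0 ρ D″≡0 , m+n≡0⇒n≡0 ρ D″≡0
                   , cong (2 +_) ([ (λ β≡0 → contradiction (subst (1 ≤_) β≡0 1≤β) 1+n≰n) , id ]′
                                  (m*n≡0⇒m≡0∨n≡0 β (m+n≡0⇒n≡0 (ρ + y + α * s) D≡0))))
    (λ { (refl , refl , refl) → Equivalence.from equiv
          (cong₂ _+_ (trans (cong (α *_) (suc-injective (suc-injective (S≡2 refl refl)))) (*-zeroʳ α)) (*-zeroʳ β)) })
attain m r q c α β ρ y {suc (suc s)} {T} 1≤β _ (inj₂ 2β<y) _ eq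
  with y′ , refl ← m≤n⇒∃[o]m+o≡n 2β<y
  with le , equiv ← halve (m + (q + (c + (α + β)))) r (suc (ρ + y′ + α * s + β * T)) (trans (attain-eq₂ m q c α β ρ y′ s T) eq) =
  le , mk⇔ (λ attained → contradiction (Equivalence.to equiv attained) λ ()) (λ { (_ , () , _) })
attain _ _ _ _ _ _ _ _ {zero} _ () _ _ _
attain _ _ _ _ _ _ _ _ {suc zero} _ (s≤s ()) _ _ _
attain _ _ _ _ _ _ _ _ {suc (suc _)} {zero} _ _ (inj₁ ()) _ _
attain _ _ _ _ _ _ _ _ {suc (suc _)} {suc zero} _ _ (inj₁ (s≤s ())) _ _

-- Losses for the four bounds, in the order of the theorem.
ρ₁ ρ₂ ρ₃ ρ₄ : ℕ → ℕ → ℕ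
ρ₁ 1 3 = 1
ρ₁ 3 1 = 1
ρ₁ 1 4 = 2
ρ₁ 4 1 = 2
ρ₁ 3 3 = 1
ρ₁ _ _ = 0

ρ₂ 2 2 = 2
ρ₂ 2 3 = 1
ρ₂ 3 2 = 1
ρ₂ 3 3 = 3
ρ₂ 3 4 = 1
ρ₂ 4 3 = 1
ρ₂ _ _ = 0

ρ₃ 2 2 = 2
ρ₃ 2 3 = 1
ρ₃ 3 2 = 1
ρ₃ 3 3 = 2
ρ₃ _ _ = 0

ρ₄ 1 4 = 2
ρ₄ 4 1 = 2
ρ₄ 2 2 = 2
ρ₄ 2 3 = 1
ρ₄ 3 2 = 1
ρ₄ 2 4 = 2
ρ₄ 4 2 = 2
ρ₄ _ _ = 0

zero-factor : ∀ k {x} → suc k * x ≡ 0 → x ≡ 0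
zero-factor k eq = [ (λ ()) , id ]′ (m*n≡0⇒m≡0∨n≡0 (suc k) eq)

module Bounds {n b : ℕ} (G : SimpleGraph (Fin n)) (1≤b : 1 ≤ b) (2b+2<n : 2 * b + 2 < n) (ct* : CT* G b) where
  open SimpleGraph G
  open Sums G public
  open Subsets G public
  open Chemical G 1≤b ct* public
  open Forest G acyclic public

  No : ℕ → Set
  No k = ∀ v → d v ≢ k

  NoEdge : ℕ → ℕ → Set
  NoEdge k l = ∀ {u v} → u ~ v → d u ≡ k → d v ≢ l

  NoEdge? : ∀ k l → (∃₂ λ u v → u ~ v × d u ≡ k × d v ≡ l) ⊎ NoEdge k l
  NoEdge? k l with Fin.any? (λ u → Fin.any? (λ v → (u ~? v) ×-dec (d u ≟ k) ×-dec (d v ≟ l)))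
  ... | yes found = inj₁ found
  ... | no  none  = inj₂ λ u~v du dv → none (_ , _ , u~v , du , dv)

  V≡0⇒No : ∀ {k} → V (is k) ≡ 0 → No k
  V≡0⇒No {k} eq v = count≡0⇒¬ (λ v → d v ≟ k) eq

  No⇒V≡0 : ∀ {k} → No k → V (is k) ≡ 0
  No⇒V≡0 {k} none = ≡0⇒sum≡0 {n} _ λ v → ⟦⟧-no (d v ≟ k) (none v)

  V-table : ∀ g h → {True (vertexTable? g h)} → V g ≡ V h
  V-table g h {table} = V-cong {g} {h} (at-vertex {g} {h} (toWitness table))

  b-split : b ≡ V (is 3) + V (is 4)
  b-split = trans (sym b≡V) (trans (V-table br (λ i → is 3 i + is 4 i)) (V-+ (is 3) (is 4)))

  n-split : n ≡ V (is 1) + V (is 2) + V br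
  n-split = trans (sym V1≡n) (trans (V-table (λ _ → 1) (λ i → is 1 i + is 2 i + br i))
    (trans (V-+ (λ i → is 1 i + is 2 i) br) (cong (_+ V br) (V-+ (is 1) (is 2)))))

  degree-split : V id ≡ V (is 1) + 2 * V (is 2) + 3 * V (is 3) + 4 * V (is 4)
  degree-split = trans (V-table id (λ i → is 1 i + 2 * is 2 i + 3 * is 3 i + 4 * is 4 i))
    (trans (V-+ (λ i → is 1 i + 2 * is 2 i + 3 * is 3 i) (λ i → 4 * is 4 i)) (cong₂ _+_
      (trans (V-+ (λ i → is 1 i + 2 * is 2 i) (λ i → 3 * is 3 i)) (cong₂ _+_
        (trans (V-+ (is 1) (λ i → 2 * is 2 i)) (cong (V (is 1) +_) (V-* 2 (is 2)))) (V-* 3 (is 3)))) (V-* 4 (is 4))))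

  -- Subtracting the vertex count from the handshake identity leaves `n - 2 = n₂ + 2 n₃ + 3 n₄`,
  -- where `n₃ + n₄ = b`.
  n-count : n ≡ V (is 2) + 2 * b + 2 + V (is 4)
  n-count = combine _ _ (sym handshake) (combine _ _ degree-split (combine _ _ (sym n-split)
    (combine _ _ (cong (3 *_) (sym b-split)) (combine _ _ (sym b≡V)
      (arith n b (V id) (V (is 1)) (V (is 2)) (V (is 3)) (V (is 4)) (V br))))))
    where
    arith : ∀ n b w p q r s vb →
      n + (w + 2) + (p + 2 * q + 3 * r + 4 * s) + n + 3 * b + vb
      ≡ q + 2 * b + 2 + s + 2 * n + w + (p + q + vb) + 3 * (r + s) + b
    arith = solve-∀

  -- In terms of the deficits `s` and `t` these are `2 + 2s` and, if there is a vertex of degree 4,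
  -- `2 + 2t`. By `gapᵇ-def` and `gap⁴-def` the truncated subtraction cuts nothing off.
  gapᵇ gap⁴ : ℕ
  gapᵇ = 2 * V br ∸ 2edges Br?
  gap⁴ = 2 * V (is 4) ∸ 2edges Four?

  private
    slack≥2 : ∀ {e x} → e + 2 ≤ x → 2 ≤ x ∸ e
    slack≥2 {e} le = m+n≤o⇒m≤o∸n 2 (≤-trans (≤-reflexive (+-comm 2 e)) le)

    slack-def : ∀ {e x} → e ≤ x → x ≡ e + (x ∸ e)
    slack-def le = sym (m+[n∸m]≡n le)

    slack≡2 : ∀ {e x} → e + 2 ≡ x → x ∸ e ≡ 2
    slack≡2 {e} refl = m+n∸m≡n e 2

  gapᵇ≥2 : 2 ≤ gapᵇ
  gapᵇ≥2 = slack≥2 {2edges Br?} (forest-bound Br? ∃branching)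

  gapᵇ-def : 2 * V br ≡ 2edges Br? + gapᵇ
  gapᵇ-def = slack-def (m+n≤o⇒m≤o (2edges Br?) (forest-bound Br? ∃branching))

  four? : (∃ λ v → d v ≡ 4) ⊎ No 4
  four? with Fin.any? Four?
  ... | yes found = inj₁ found
  ... | no  none  = inj₂ λ v dv → none (v , dv)

  gap⁴≥2 : (∃ λ v → d v ≡ 4) → 2 ≤ gap⁴
  gap⁴≥2 four = slack≥2 {2edges Four?} (forest-bound Four? four)

  gap⁴-def : 2 * V (is 4) ≡ 2edges Four? + gap⁴
  gap⁴-def with four?
  ... | inj₁ four = slack-def (m+n≤o⇒m≤o (2edges Four?) (forest-bound Four? four))
  ... | inj₂ none = slack-def (≤-trans (≤-reflexive (2edges-empty Four? (No⇒V≡0 none))) z≤n)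

  gap⁴≡2⇔tight : gap⁴ ≡ 2 ⇔ Tight Four?
  gap⁴≡2⇔tight = mk⇔ (λ gap⁴≡2 → sym (trans gap⁴-def (cong (2edges Four? +_) gap⁴≡2))) (slack≡2 {2edges Four?})

  -- Without degree 3 the branching vertices are exactly those of degree 4, so the two gaps agree.
  no3⇒gapᵇ≡2 : No 3 → gap⁴ ≡ 2 → gapᵇ ≡ 2
  no3⇒gapᵇ≡2 no3 = subst₂ (λ x e → 2 * x ∸ e ≡ 2)
    (V-cong {is 4} {br} is4≡br)
    (trans (2edges≡E (_≟ 4)) (trans (E-cong {λ i j → is 4 i * is 4 j} {λ i j → br i * br j}
      λ {u} {v} _ → cong₂ _*_ (is4≡br u) (is4≡br v)) (sym (2edges≡E (2 <?_)))))
    where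
    is4≡br : ∀ v → is 4 (d v) ≡ br (d v)
    is4≡br v = trans (cong (_+ is 4 (d v)) (sym (⟦⟧-no (d v ≟ 3) (no3 v))))
      (sym (at-vertex {br} {λ i → is 3 i + is 4 i} (from-yes (vertexTable? br (λ i → is 3 i + is 4 i))) v))

  -- Without degree 2 every edge either joins two branching vertices or has exactly one pendent end.
  -- Removing the pendent vertices thus removes as many edges as vertices and leaves a tree.
  no2⇒gapᵇ≡2 : No 2 → gapᵇ ≡ 2
  no2⇒gapᵇ≡2 no2 = slack≡2 {2edges Br?} (combine _ _ edge-split (combine _ _ handshake (combine _ _ (cong (2 *_) n-split)
      (combine _ _ (cong (2 *_) (No⇒V≡0 no2)) (arith (2edges Br?) (V (is 1)) (V (is 2)) (V br) (V id) n)))))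
    where
    edge-split : 2edges Br? + 2 * V (is 1) ≡ V id
    edge-split = begin
      2edges Br? + 2 * V (is 1)
        ≡⟨ cong₂ _+_ (2edges≡E (2 <?_)) (sym (trans (E-ends (is 1)) (trans (V-table (λ i → 2 * (i * is 1 i)) (λ i → 2 * is 1 i)) (V-* 2 (is 1))))) ⟩
      E (λ i j → br i * br j) + E (λ i j → is 1 i + is 1 j)
        ≡⟨ E-+ (λ i j → br i * br j) (λ i j → is 1 i + is 1 j) ⟨
      E (λ i j → br i * br j + (is 1 i + is 1 j))
        ≡⟨ E-cong {λ i j → br i * br j + (is 1 i + is 1 j)} {λ _ _ → 1} one ⟩
      E (λ _ _ → 1)
        ≡⟨ trans (E-tail (λ _ → 1)) (V-cong {λ i → i * 1} {id} λ v → *-identityʳ (d v)) ⟩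
      V id ∎
      where
      open ≡-Reasoning
      -- The two extra terms make the table correct also at edges that meet a vertex of degree 2.
      f : ℕ → ℕ → ℕ
      f i j = br i * br j + (is 1 i + is 1 j) + (1 ∸ is 1 j) * is 2 i + br i * is 2 j
      drop : ∀ x y z → x + y * 0 + z * 0 ≡ x
      drop = solve-∀
      one : ∀ {u v} → u ~ v → br (d u) * br (d v) + (is 1 (d u) + is 1 (d v)) ≡ 1
      one {u} {v} u~v = begin
        x                              ≡⟨ drop x y z ⟨
        x + y * 0 + z * 0              ≡⟨ cong₂ (λ s t → x + y * s + z * t) (⟦⟧-no (d u ≟ 2) (no2 u)) (⟦⟧-no (d v ≟ 2) (no2 v)) ⟨
        f (d u) (d v)                  ≡⟨ at-edge {f} {λ _ _ → 1} (from-yes (edgeTable? f (λ _ _ → 1))) u~v ⟩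
        1                              ∎
        where
        x = br (d u) * br (d v) + (is 1 (d u) + is 1 (d v))
        y = 1 ∸ is 1 (d v)
        z = br (d u)
    arith : ∀ e p q vb w n →
      e + 2 + w + 2 * n + 2 * (p + q + vb) + 2 * 0 ≡ 2 * vb + (e + 2 * p) + (w + 2) + 2 * n + 2 * q
    arith = solve-∀

  private
    -- `deficit-identity` is passed to `attain`. On the left, `q` is the part of the bound that is
    -- subtracted and depends on `b`; the constant `c + (α + β)` comes, after halving, from the
    -- handshake identities and from the summand 2 in each gap.
    close : ∀ α β c q (ρ : ℕ → ℕ → ℕ) (h gˡ gʳ : ℕ → ℕ) y r →
            {True (edgeTable? (edgeˡ ρ) (edgeʳ α β h))} → {True (vertexTable? (vertexˡ α β c h gˡ) (vertexʳ c gʳ))} →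
            1 ≤ β → (No 4 → 2 * β < y) → (y ≡ 0 → gap⁴ ≡ 2 → gapᵇ ≡ 2) →
            V gˡ ≡ y + 2 * q → V gʳ ≡ 2 * r →
            M₂ G + (q + (c + (α + β))) ≤ r × (M₂ G + (q + (c + (α + β))) ≡ r ⇔ (E ρ ≡ 0 × y ≡ 0 × gap⁴ ≡ 2))
    close α β c q ρ h gˡ gʳ y r {edge} {vertex} 1≤β no4 S≡2 left right = attain (M₂ G) r q c α β (E ρ) y 1≤β gapᵇ≥2
      ([ inj₁ ∘ gap⁴≥2 , inj₂ ∘ no4 ]′ four?) S≡2
      (trans (cong (λ x → 2 * M₂ G + (E ρ + x + α * gapᵇ + β * gap⁴) + c * 2) (sym left))
             (trans (deficit-identity α β c ρ h gˡ gʳ (toWitness edge) (toWitness vertex) gapᵇ-def gap⁴-def) right))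

    n3>0 : No 4 → 1 ≤ V (is 3)
    n3>0 none = subst (1 ≤_) (trans b-split (trans (cong (V (is 3) +_) (No⇒V≡0 none)) (+-identityʳ _))) 1≤b

    n2>0 : No 4 → 1 ≤ V (is 2)
    n2>0 none = +-cancelˡ-≤ (2 * b + 2) _ _ (begin
      2 * b + 2 + 1               ≡⟨ +-comm (2 * b + 2) 1 ⟩
      suc (2 * b + 2)             ≤⟨ 2b+2<n ⟩
      n                           ≡⟨ n-count ⟩
      V (is 2) + 2 * b + 2 + V (is 4) ≡⟨ cong (V (is 2) + 2 * b + 2 +_) (No⇒V≡0 none) ⟩
      V (is 2) + 2 * b + 2 + 0    ≡⟨ swap (V (is 2)) b ⟩
      2 * b + 2 + V (is 2)        ∎)
      where
      open ≤-Reasoning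
      swap : ∀ q b → q + 2 * b + 2 + 0 ≡ 2 * b + 2 + q
      swap = solve-∀

    outweigh : ∀ {x} k m → m < k → 1 ≤ x → m < k * x
    outweigh {x} k m m<k 1≤x = ≤-trans m<k (≤-trans (≤-reflexive (sym (*-identityʳ k))) (*-monoʳ-≤ k 1≤x))

    const-V : ∀ k → V (λ _ → k) ≡ n * k
    const-V k = trans (V-cong {λ _ → k} {λ _ → k * 1} λ _ → sym (*-identityʳ k))
      (trans (V-* k (λ _ → 1)) (trans (cong (k *_) V1≡n) (*-comm k n)))

    linear-V : ∀ j k → V (λ i → j + k * br i) ≡ n * j + k * b
    linear-V j k = trans (V-+ (λ _ → j) (λ i → k * br i)) (cong₂ _+_ (const-V j) (trans (V-* k br) (cong (k *_) b≡V)))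

    plus-V : ∀ j k → V (λ i → j * is 2 i + k * br i) ≡ j * V (is 2) + k * b
    plus-V j k = trans (V-+ (λ i → j * is 2 i) (λ i → k * br i)) (cong₂ _+_ (V-* j (is 2)) (trans (V-* k br) (cong (k *_) b≡V)))

  -- In all four cases the losses appear doubled: `20 * V (is 3)` stands for `10 n₃`, and the first
  -- two arguments of `close` are the coefficients of `s` and `t`. The weights are the values of `h`
  -- at the degrees 1 to 4, and both tables are verified by evaluation.
  case₁ : M₂ G + 12 ≤ 4 * n + 16 * b × (M₂ G + 12 ≡ 4 * n + 16 * b ⇔ (E ρ₁ ≡ 0 × 20 * V (is 3) ≡ 0 × gap⁴ ≡ 2))
  case₁ = close 2 2 8 0 ρ₁ (weights 1 3 5 7) (λ i → 20 * is 3 i) (λ i → 8 + 32 * br i)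
    (20 * V (is 3)) (4 * n + 16 * b) (s≤s z≤n) (outweigh 20 4 (from-yes (4 <? 20)) ∘ n3>0)
    (λ y≡0 → no3⇒gapᵇ≡2 (V≡0⇒No (zero-factor 19 y≡0)))
    (trans (V-* 20 (is 3)) (sym (+-identityʳ (20 * V (is 3))))) (trans (linear-V 8 32) (arith n b))
    where
    arith : ∀ n b → n * 8 + 32 * b ≡ 2 * (4 * n + 16 * b)
    arith = solve-∀

  case₂ : M₂ G + 20 ≤ 6 * n + 6 * b × (M₂ G + 20 ≡ 6 * n + 6 * b ⇔ (E ρ₂ ≡ 0 × 6 * V (is 3) ≡ 0 × gap⁴ ≡ 2))
  case₂ = close 4 2 14 0 ρ₂ (weights 0 4 5 6) (λ i → 6 * is 3 i) (λ i → 12 + 12 * br i)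
    (6 * V (is 3)) (6 * n + 6 * b) (s≤s z≤n) (outweigh 6 4 (from-yes (4 <? 6)) ∘ n3>0)
    (λ y≡0 → no3⇒gapᵇ≡2 (V≡0⇒No (zero-factor 5 y≡0)))
    (trans (V-* 6 (is 3)) (sym (+-identityʳ (6 * V (is 3))))) (trans (linear-V 12 12) (arith n b))
    where
    arith : ∀ n b → n * 12 + 12 * b ≡ 2 * (6 * n + 6 * b)
    arith = solve-∀

  case₃ : M₂ G + (6 * b + 28) ≤ 10 * n × (M₂ G + (6 * b + 28) ≡ 10 * n ⇔ (E ρ₃ ≡ 0 × 8 * V (is 2) ≡ 0 × gap⁴ ≡ 2))
  case₃ = close 3 3 22 (6 * b) ρ₃ (weights 0 4 5 6) (λ i → 8 * is 2 i + 12 * br i) (λ _ → 20)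
    (8 * V (is 2)) (10 * n) (s≤s z≤n) (outweigh 8 6 (from-yes (6 <? 8)) ∘ n2>0)
    (λ y≡0 _ → no2⇒gapᵇ≡2 (V≡0⇒No (zero-factor 7 y≡0)))
    (trans (plus-V 8 12) (cong (8 * V (is 2) +_) (left b))) (trans (const-V 20) (right n))
    where
    left : ∀ b → 12 * b ≡ 2 * (6 * b)
    left = solve-∀
    right : ∀ n → n * 20 ≡ 2 * (10 * n)
    right = solve-∀

  case₄ : M₂ G + (20 * b + 36) ≤ 16 * n × (M₂ G + (20 * b + 36) ≡ 16 * n ⇔ (E ρ₄ ≡ 0 × 20 * V (is 2) ≡ 0 × gap⁴ ≡ 2))
  case₄ = close 1 1 34 (20 * b) ρ₄ (weights 0 4 5 8) (λ i → 20 * is 2 i + 40 * br i) (λ _ → 32)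
    (20 * V (is 2)) (16 * n) (s≤s z≤n) (outweigh 20 2 (from-yes (2 <? 20)) ∘ n2>0)
    (λ y≡0 _ → no2⇒gapᵇ≡2 (V≡0⇒No (zero-factor 19 y≡0)))
    (trans (plus-V 20 40) (cong (20 * V (is 2) +_) (left b))) (trans (const-V 32) (right n))
    where
    left : ∀ b → 40 * b ≡ 2 * (20 * b)
    left = solve-∀
    right : ∀ n → n * 32 ≡ 2 * (16 * n)
    right = solve-∀

-- Extremal trees

module Characterisation {n b : ℕ} (G : SimpleGraph (Fin n)) (1≤b : 1 ≤ b) (2b+2<n : 2 * b + 2 < n) (ct* : CT* G b) where
  open SimpleGraph G
  open Bounds G 1≤b 2b+2<n ct* public
  open Paths G acyclic

  private
    Bad : ℕ → ℕ → ℕ → ℕ → ℕ → Set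
    Bad k p q i j = i ≡ k ⊎ j ≡ k ⊎ (i ≡ p × j ≡ q) ⊎ (i ≡ q × j ≡ p)

    bad? : ∀ k p q i j → Dec (Bad k p q i j)
    bad? k p q i j = (i ≟ k) ⊎-dec ((j ≟ k) ⊎-dec (((i ≟ p) ×-dec (j ≟ q)) ⊎-dec ((i ≟ q) ×-dec (j ≟ p))))

    -- By the table, the loss is zero except at edges that meet degree `k` or join degrees `p` and
    -- `q`. Once degree `k` is absent, the total loss vanishes exactly when no edge joins `p` and
    -- `q`.
    critical : ∀ ρ c k p q → {True (edgeTable? ρ (λ i j → ρ i j * ⟦ bad? k p q i j ⟧))} → {True (0 <? ρ p q)} →
               (E ρ ≡ 0 × suc c * V (is k) ≡ 0 × gap⁴ ≡ 2) ⇔ (No k × Tight Four? × NoEdge p q)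
    critical ρ c k p q {table} {positive} = mk⇔
      (λ (Eρ≡0 , Vk≡0 , gap⁴≡2) → V≡0⇒No (zero-factor c Vk≡0) , Equivalence.to gap⁴≡2⇔tight gap⁴≡2
        , λ u~v du dv → <⇒≢ (toWitness positive) (sym (subst₂ (λ i j → ρ i j ≡ 0) du dv (E≡0⇒ {ρ} Eρ≡0 u~v))))
      (λ (absent , tight , none) → E≡0⇐ {ρ} (λ {u} {v} u~v → trans (at-edge {ρ} {λ i j → ρ i j * ⟦ bad? k p q i j ⟧} (toWitness table) u~v)
           (trans (cong (ρ (d u) (d v) *_) (⟦⟧-no (bad? k p q (d u) (d v)) (good absent none u~v))) (*-zeroʳ (ρ (d u) (d v)))))
        , trans (cong (suc c *_) (No⇒V≡0 absent)) (*-zeroʳ (suc c)) , Equivalence.from gap⁴≡2⇔tight tight)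
      where
      good : No k → NoEdge p q → ∀ {u v} → u ~ v → ¬ Bad k p q (d u) (d v)
      good absent none u~v (inj₁ du)                      = absent _ du
      good absent none u~v (inj₂ (inj₁ dv))               = absent _ dv
      good absent none u~v (inj₂ (inj₂ (inj₁ (du , dv)))) = none u~v du dv
      good absent none u~v (inj₂ (inj₂ (inj₂ (du , dv)))) = none (~-sym u~v) dv du

  equality₁ : M₂ G + 12 ≡ 4 * n + 16 * b ⇔ (No 3 × Tight Four? × NoEdge 1 4)
  equality₁ = critical ρ₁ 19 3 1 4 ⇔-∘ proj₂ case₁

  equality₂ : M₂ G + 20 ≡ 6 * n + 6 * b ⇔ (No 3 × Tight Four? × NoEdge 2 2)
  equality₂ = critical ρ₂ 5 3 2 2 ⇔-∘ proj₂ case₂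

  equality₃ : M₂ G + (6 * b + 28) ≡ 10 * n ⇔ (No 2 × Tight Four? × NoEdge 3 3)
  equality₃ = critical ρ₃ 7 2 3 3 ⇔-∘ proj₂ case₃

  equality₄ : M₂ G + (20 * b + 36) ≡ 16 * n ⇔ (No 2 × Tight Four? × NoEdge 1 4)
  equality₄ = critical ρ₄ 19 2 1 4 ⇔-∘ proj₂ case₄

  d≡4 : No 3 → ∀ {v} → Branching G v → d v ≡ 4
  d≡4 no3 {v} 2<d = ≤-antisym (d≤4 v) (≤∧≢⇒< 2<d (no3 v ∘ sym))

  private
    Four : Pred (Fin n) 0ℓ
    Four v = d v ≡ 4

    -- The proof stored in a refinement is irrelevant; decidability of equality recovers a usable
    -- one.
    relevant : (u : Refinement (Fin n) Four) → d (value u) ≡ 4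
    relevant (u , [ four ]) = recompute (d u ≟ 4) four

  induced-connected : ConnectedIn Four → Connected (induced G Four)
  induced-connected conn u w = lift u (conn (relevant u) (relevant w)) w refl
    where
    lift : ∀ (u : Refinement (Fin n) Four) {y} → Star (λ a b → d b ≡ 4 × a ~ b) (value u) y →
           ∀ w → value w ≡ y → Star (SimpleGraph._~_ (induced G Four)) u w
    lift u ε (_ , _) refl = ε
    lift u (_◅_ {j = z} (dz , u~z) walk) w eq = _◅_ {j = z , [ dz ]} u~z (lift (z , [ dz ]) walk w eq)

  connected-induced : Connected (induced G Four) → ConnectedIn Four
  connected-induced conn {x} {y} dx dy = Star.gmap value (λ {_} {w} u~w → relevant w , u~w) (conn (x , [ dx ]) (y , [ dy ]))

  induced-acyclic : Acyclic (induced G Four)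
  induced-acyclic u us (2≤ , unique , linked) = acyclic (value u) (List.map value us)
    ( subst (2 ≤_) (sym (length-map value us)) 2≤
    , Unique.map⁺ value-injective unique
    , subst (λ xs → Linked _~_ (value u ∷ xs)) (map-++ value us (u ∷ [])) (Linked.map⁺ linked) )
    where
    value-injective : {x y : Refinement (Fin n) Four} → value x ≡ value y → x ≡ y
    value-injective {_ , _} {_ , _} refl = refl

  tree4⇔tight : (∃ λ v → d v ≡ 4) → IsTree (induced G Four) ⇔ Tight Four?
  tree4⇔tight four = mk⇔ (λ tree → connected⇒tight Four? four (connected-induced (proj₁ tree)))
                         (λ tight → induced-connected (tight⇒connected Four? tight) , induced-acyclic)

  -- Paths through vertices of degree 2

  degree≡2 : ∀ {c x y} → ¬ Branching G c → c ~ x → c ~ y → x ≢ y → d c ≡ 2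
  degree≡2 {c} 2≮dc c~x c~y x≢y = ≤-antisym (≮⇒≥ 2≮dc)
    (subst (2 ≤_) (sym (degree≡count c)) (≢⇒count≥2 (c ~?_) c~x c~y x≢y))

  other-neighbour : ∀ {u v} → d u ≡ 2 → ∃ λ w → w ~ u × w ≢ v
  other-neighbour {u} {v} du
    with w , u~w , w≢v ← count≥2⇒∃≢ (u ~?_) (≤-reflexive (trans (sym du) (degree≡count u))) v
    = w , ~-sym u~w , w≢v

  -- Induction along the walk, whose next vertex is `c`. If neither `v` nor `c` is branching, the
  -- path found from `c` either steps back to `v`, and then its tail serves, or can be preceded by
  -- `v`. In the latter case `c` has two distinct neighbours and, not being branching, degree 2.
  branching-end : ∀ {v p} → Star _~_ v p → Branching G p →
                  Branching G v ⊎ ∃₂ λ us p → IsPath G (v ∷ us ∷ʳ p) × Branching G p × All (λ u → d u ≡ 2) us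
  branching-end ε 2<d = inj₁ 2<d
  branching-end {v} (_◅_ {j = c} v~c walk) 2<dp with Br? v | Br? c | branching-end walk 2<dp
  ... | yes 2<dv | _ | _ = inj₁ 2<dv
  ... | no _ | yes 2<dc | _ = inj₂ ([] , c , (v~c ∷ [-] , ((λ v≡c → irrefl v≡c v~c) ∷ []) ∷ [] ∷ []) , 2<dc , [])
  ... | no _ | no 2≮dc | inj₁ 2<dc = contradiction 2<dc 2≮dc
  ... | no 2≮dv | no 2≮dc | inj₂ ([] , p , path@(c~p ∷ _ , _) , 2<dp , twos) =
    inj₂ (c ∷ [] , p , cons-path path v~c (λ { refl → 2≮dv 2<dp }) , 2<dp
         , degree≡2 2≮dc (~-sym v~c) c~p (λ { refl → 2≮dv 2<dp }) ∷ [])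
  ... | no 2≮dv | no 2≮dc | inj₂ (x ∷ us , p , path@(c~x ∷ linked , _ ∷ unique) , 2<dp , dx ∷ twos) with v Fin.≟ x
  ...   | yes refl = inj₂ (us , p , (linked , unique) , 2<dp , twos)
  ...   | no v≢x = inj₂ (c ∷ x ∷ us , p , cons-path path v~c v≢x , 2<dp , degree≡2 2≮dc (~-sym v~c) c~x v≢x ∷ dx ∷ twos)

  private
    -- The path is continued beyond `y` until the degree is not 2. A branching vertex there would
    -- give an internal path of length at least 3, so the end is pendent.
    prolong : (∀ u us w → InternalPath G u us w → pathLength G us ≡ 1) →
              ∀ {y y′ us p} → IsPath G (y ∷ y′ ∷ us ∷ʳ p) → Branching G p → d y ≡ 2 → d y′ ≡ 2 → All (λ u → d u ≡ 2) us →
              ∃ λ u → ∃₂ λ us w → PendentPath G u us w × pathLength G us > 2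
    prolong short {y} {y′} {us} {p} path 2<dp dy dy′ twos
      with z , pre , path′ , _ , dz≢2 , pre-twos ← extend-path {P = U} {λ v → d v ≢ 2} (λ v → ¬? (d v ≟ 2))
             -- Stopping means degree other than 2; until then the vertex has a second neighbour
             -- through which the path goes on.
             (λ {u} _ ¬¬du≡2 _ → let w , w~u , w≢v = other-neighbour (decidable-stable (d u ≟ 2) ¬¬du≡2) in w , tt , w~u , w≢v)
             path tt (λ dy≢2 → dy≢2 dy)
      with path″ ← subst (λ xs → IsPath G (z ∷ xs)) (sym (++-assoc pre (y ∷ y′ ∷ us) (p ∷ []))) path′
      with mid-twos ← All.++⁺ (All.map (λ {v} → decidable-stable (d v ≟ 2)) pre-twos) (dy ∷ dy′ ∷ twos)
      with long ← s≤s (≤-trans (s≤s (s≤s z≤n)) (≤-trans (m≤n+m (length (y ∷ y′ ∷ us)) (length pre)) (≤-reflexive (sym (length-++ pre)))))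
      with Br? z
    ... | yes 2<dz = contradiction (short z (pre ++ y ∷ y′ ∷ us) p (path″ , 2<dz , 2<dp , mid-twos)) (>⇒≢ (<-trans (n<1+n 1) long))
    ... | no 2≮dz = z , pre ++ y ∷ y′ ∷ us , p
      , (path″ , ≤-antisym (s≤s⁻¹ (≤∧≢⇒< (≮⇒≥ 2≮dz) dz≢2)) (d>0 z) , 2<dp , mid-twos) , long

  -- A path from `u` to a branching vertex either begins with the edge to `v` or can be preceded by
  -- `v`. In both cases its first two vertices have degree 2, and it can be prolonged.
  long-pendent-path : (∀ u us w → InternalPath G u us w → pathLength G us ≡ 1) → ∀ {u v} → u ~ v → d u ≡ 2 → d v ≡ 2 →
                      ∃ λ u → ∃₂ λ us w → PendentPath G u us w × pathLength G us > 2
  long-pendent-path short {u} {v} u~v du dv with branching-end (connected u (proj₁ ∃branching)) (proj₂ ∃branching)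
  ... | inj₁ 2<du = contradiction du (>⇒≢ 2<du)
  ... | inj₂ ([] , p , path , 2<dp , _) = prolong short {us = []} (cons-path path (~-sym u~v) λ { refl → >⇒≢ 2<dp dv }) 2<dp dv du []
  ... | inj₂ (x ∷ us , p , path , 2<dp , dx ∷ twos) with v Fin.≟ x
  ...   | yes refl = prolong short path 2<dp du dv twos
  ...   | no v≢x   = prolong short (cons-path path (~-sym u~v) v≢x) 2<dp dv du (dx ∷ twos)

  -- The equality cases of the smaller bound in each half of the range of `b`, as they come out of
  -- the deficits. They are shown below to be equivalent to `BT₁′` and `BT₂′`.
  K₁ K₂ : Set
  K₁ = No 3 × Tight Four? × (NoEdge 1 4 ⊎ NoEdge 2 2)
  K₂ = No 2 × Tight Four? × (NoEdge 1 4 ⊎ NoEdge 3 3)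

  n4≡b : No 3 → V (is 4) ≡ b
  n4≡b no3 = sym (trans b-split (cong (_+ V (is 4)) (No⇒V≡0 no3)))

  n4+2b+2≡n : No 2 → V (is 4) + (2 * b + 2) ≡ n
  n4+2b+2≡n no2 = sym (trans n-count (trans (cong (λ x → x + 2 * b + 2 + V (is 4)) (No⇒V≡0 no2)) (+-comm (2 * b + 2) (V (is 4)))))

  n2+3b+2≡n : No 3 → V (is 2) + (3 * b + 2) ≡ n
  n2+3b+2≡n no3 = sym (trans n-count (trans (cong (V (is 2) + 2 * b + 2 +_) (n4≡b no3)) (arith (V (is 2)) b)))
    where
    arith : ∀ q b → q + 2 * b + 2 + b ≡ q + (3 * b + 2)
    arith = solve-∀

  n1≡2b+2 : No 3 → V (is 1) ≡ 2 * b + 2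
  n1≡2b+2 no3 = combine _ _ (sym n-split) (combine _ _ n-count (combine _ _ (n4≡b no3) (combine _ _ (sym b≡V)
    (arith (V (is 1)) (V (is 2)) (V (is 4)) (V br) n b))))
    where
    arith : ∀ p q s vb n b → p + n + (q + 2 * b + 2 + s) + b + vb ≡ 2 * b + 2 + (p + q + vb) + n + s + b
    arith = solve-∀

  n3+n≡3b+2 : No 2 → V (is 3) + n ≡ 3 * b + 2
  n3+n≡3b+2 no2 = combine _ _ (sym (n4+2b+2≡n no2)) (combine _ _ (sym b-split) (arith (V (is 3)) (V (is 4)) n b))
    where
    arith : ∀ r s n b → r + n + (s + (2 * b + 2)) + b ≡ 3 * b + 2 + n + (r + s)
    arith = solve-∀

  n1+b≡n : No 2 → V (is 1) + b ≡ n
  n1+b≡n no2 = sym (trans n-split (trans (cong₂ (λ x y → V (is 1) + x + y) (No⇒V≡0 no2) b≡V) (cong (_+ b) (+-identityʳ _))))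

  K₁⇒Conditions : K₁ → Conditions G
  K₁⇒Conditions (no3 , tight , no14⊎no22) = record
    { internalPathsShort = λ u us w (path , 2<du , 2<dw , twos) → cong (suc ∘ length)
        (no-ear us Four? tight (d≡4 no3 2<du) (d≡4 no3 2<dw) path (All.map (λ two four → contradiction (trans (sym two) four) λ ()) twos))
    ; noAdjacent3s       = λ _ (u , _ , _ , du , _) → no3 u du
    ; noLongPendentPath  = λ (_ , _ , u~v , du , 2<dv) (_ , us , _ , (path , _ , _ , twos) , long) →
        [ (λ (no14 : NoEdge 1 4) → no14 u~v du (d≡4 no3 2<dv)) , (λ (no22 : NoEdge 2 2) → no22-short no22 us path twos long) ]′ no14⊎no22
    ; atMostOne4         = λ v dv → contradiction dv (no3 v)
    ; has4               = four
    ; tree4              = Equivalence.from (tree4⇔tight four) tight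
    }
    where
    four : ∃ λ v → d v ≡ 4
    four = count>0⇒∃ Four? (subst (1 ≤_) (sym (n4≡b no3)) 1≤b)
    no22-short : NoEdge 2 2 → ∀ {u w} us → IsPath G (u ∷ us ∷ʳ w) → All (λ v → d v ≡ 2) us → ¬ pathLength G us > 2
    no22-short no22 []          _ _ (s≤s ())
    no22-short no22 (_ ∷ [])    _ _ (s≤s (s≤s ()))
    no22-short no22 (_ ∷ _ ∷ _) (_ ∷ x~y ∷ _ , _) (dx ∷ dy ∷ _) _ = no22 x~y dx dy

  K₂⇒Conditions : K₂ → Conditions G
  K₂⇒Conditions (no2 , tight , no14⊎no33) = record
    { internalPathsShort = λ { _ []       _ _                     → refl
                             ; _ (x ∷ _) _ (_ , _ , _ , dx ∷ _) → contradiction dx (no2 x) }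
    ; noAdjacent3s       = λ (_ , _ , u~v , du , dv) (_ , _ , u~v′ , du′ , dv′) →
        [ (λ (no14 : NoEdge 1 4) → no14 u~v du dv) , (λ (no33 : NoEdge 3 3) → no33 u~v′ du′ dv′) ]′ no14⊎no33
    ; noLongPendentPath  = λ { _ (_ , []    , _ , _                         , s≤s ())
                             ; _ (_ , x ∷ _ , _ , (_ , _ , _ , dx ∷ _) , _) → no2 x dx }
    ; atMostOne4         = λ v dv → subst (_≤ 1) (sym (length-filter-tabulate (λ u → (v ~? u) ×-dec (d u ≟ 4)) id))
        -- A vertex of degree 3 lies outside the tight set of vertices of degree 4.
        (tight⇒neighbours≤1 Four? tight {v} λ four → contradiction (trans (sym dv) four) λ ())
    ; has4               = four
    ; tree4              = Equivalence.from (tree4⇔tight four) tight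
    }
    where
    four : ∃ λ v → d v ≡ 4
    -- The number of vertices of degree 4 is `n - 2b - 2`, which is positive.
    four = count>0⇒∃ Four? (+-cancelʳ-< (2 * b + 2) 0 (V (is 4)) (subst (2 * b + 2 <_) (sym (n4+2b+2≡n no2)) 2b+2<n))

  Conditions⇒tight : Conditions G → Tight Four?
  Conditions⇒tight cs = Equivalence.to (tree4⇔tight (Conditions.has4 cs)) (Conditions.tree4 cs)

  -- An edge between two vertices of degree 2 lies on a pendent path of length greater than 2, which
  -- condition (3) forbids next to an edge joining degrees 1 and 4.
  Conditions⇒no14⊎no22 : Conditions G → NoEdge 1 4 ⊎ NoEdge 2 2
  Conditions⇒no14⊎no22 cs with NoEdge? 1 4 | NoEdge? 2 2
  ... | inj₂ no14 | _ = inj₁ no14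
  ... | inj₁ _    | inj₂ no22 = inj₂ no22
  ... | inj₁ (u , v , u~v , du , dv) | inj₁ (x , y , x~y , dx , dy) =
    contradiction (long-pendent-path (Conditions.internalPathsShort cs) x~y dx dy)
      (Conditions.noLongPendentPath cs (u , v , u~v , du , subst (2 <_) (sym dv) (from-yes (2 <? 4))))

  Conditions⇒no14⊎no33 : Conditions G → NoEdge 1 4 ⊎ NoEdge 3 3
  Conditions⇒no14⊎no33 cs with NoEdge? 1 4
  ... | inj₂ no14 = inj₁ no14
  ... | inj₁ edge = inj₂ λ u~v du dv → Conditions.noAdjacent3s cs edge (_ , _ , u~v , du , dv)

-- Comparison of the bounds

squeeze : ∀ {m x y X Y} → m + x ≤ X → m + y ≡ Y → X + y ≤ Y + x → m + x ≡ X
squeeze {m} {x} {y} {X} bound refl compare = ≤-antisym bound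
  (+-cancelʳ-≤ y X (m + x) (≤-trans compare (≤-reflexive (swap m x y))))
  where
  swap : ∀ m x y → m + y + x ≡ m + x + y
  swap = solve-∀

-- The smaller of two bounds is attained as soon as either of them is.
least-bound : ∀ m {x y X Y} {A B C D : Set} → m + x ≤ X → X + y ≤ Y + x →
              m + x ≡ X ⇔ (A × B × C) → m + y ≡ Y ⇔ (A × B × D) → m + x ≡ X ⇔ (A × B × (C ⊎ D))
least-bound m bound compare attained attained′ = mk⇔
  (λ eq → Product.map₂ (Product.map₂ inj₁) (Equivalence.to attained eq))
  (λ { (a , b , inj₁ c) → Equivalence.from attained (a , b , c)
     ; (a , b , inj₂ e) → squeeze bound (Equivalence.from attained′ (a , b , e)) compare })

-- Two neighbouring bounds differ by twice the difference of the two sides of the inequality that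
-- separates their ranges; `a` is what the rearranged sides have in common.
+2*-mono : ∀ {x y i j} a → x ≡ a + 2 * i → y ≡ a + 2 * j → i ≤ j → x ≤ y
+2*-mono a refl refl i≤j = +-monoʳ-≤ a (*-monoʳ-≤ 2 i≤j)

-- Passage to integers and to the classes of extremal trees

open import Data.Integer using (+_) renaming (_-_ to _-ℤ_; _≤_ to _≤ℤ_)

+≤+-- : ∀ {m r} k → m + k ≤ r → + m ≤ℤ + r -ℤ + k
+≤+-- {m} {r} k le = subst (+ m ≤ℤ_)
  (trans (sym (ℤ.⊖-≥ (m+n≤o⇒n≤o m le))) (sym (ℤ.m-n≡m⊖n r k))) (ℤ.+≤+ (m+n≤o⇒m≤o∸n m le))

+≡+-- : ∀ {m r} k → m + k ≡ r ⇔ + m ≡ + r -ℤ + k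
+≡+-- {m} {r} k = mk⇔
  (λ { refl → sym (trans (cong (_-ℤ + k) (ℤ.pos-+ m k)) (cancel (+ m) (+ k))) })
  (λ eq → ℤ.+-injective (trans (ℤ.pos-+ m k) (trans (cong (λ i → i ℤ.+ + k) eq) (restore (+ r) (+ k)))))
  where
  cancel : ∀ i j → i ℤ.+ j -ℤ j ≡ i
  cancel i j = trans (ℤ.+-assoc i j (ℤ.- j)) (trans (cong (λ k → i ℤ.+ k) (ℤ.+-inverseʳ j)) (ℤ.+-identityʳ i))
  restore : ∀ i j → i -ℤ j ℤ.+ j ≡ i
  restore i j = trans (ℤ.+-assoc i (ℤ.- j) j) (trans (cong (λ k → i ℤ.+ k) (ℤ.+-inverseˡ j)) (ℤ.+-identityʳ i))

-‿-‿+ : ∀ r q k → + r -ℤ + q -ℤ + k ≡ + r -ℤ + (q + k)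
-‿-‿+ r q k = trans (ℤ.+-assoc (+ r) (ℤ.- + q) (ℤ.- + k))
  (cong (λ i → + r ℤ.+ i) (trans (sym (ℤ.neg-distrib-+ (+ q) (+ k))) (cong ℤ.-_ (sym (ℤ.pos-+ q k)))))

module _ {n b : ℕ} (G : SimpleGraph (Fin n)) (1≤b : 1 ≤ b) (2b+2<n : 2 * b + 2 < n) (ct* : CT* G b) where
  open Characterisation G 1≤b 2b+2<n ct*

  K₁⇔BT₁′ : K₁ ⇔ BT₁′ G b
  K₁⇔BT₁′ = mk⇔
    (λ k₁@(no3 , _) →
      ( ct*
      , trans (#entries≡V 4) (n4≡b no3)
      , trans (Equivalence.to (+≡+-- (3 * b + 2)) (trans (cong (λ x → x + (3 * b + 2)) (#entries≡V 2)) (n2+3b+2≡n no3)))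
              (sym (-‿-‿+ n (3 * b) 2))
      , trans (#entries≡V 1) (n1≡2b+2 no3) )
      , K₁⇒Conditions k₁)
    (λ ((_ , #4≡b , _) , cs) →
      -- Since `n₃ + n₄ = b`, the prescribed `n₄ = b` forces `n₃ = 0`.
      V≡0⇒No (+-cancelʳ-≡ (V (is 4)) (V (is 3)) 0 (trans (sym b-split) (trans (sym #4≡b) (#entries≡V 4))))
      , Conditions⇒tight cs , Conditions⇒no14⊎no22 cs)

  K₂⇔BT₂′ : K₂ ⇔ BT₂′ G b
  K₂⇔BT₂′ = mk⇔
    (λ k₂@(no2 , _) →
      ( ct*
      , trans (Equivalence.to (+≡+-- (2 * b + 2)) (trans (cong (λ x → x + (2 * b + 2)) (#entries≡V 4)) (n4+2b+2≡n no2)))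
              (sym (-‿-‿+ n (2 * b) 2))
      , Equivalence.to (+≡+-- n) (trans (cong (λ x → x + n) (#entries≡V 3)) (n3+n≡3b+2 no2))
      , Equivalence.to (+≡+-- b) (trans (cong (λ x → x + b) (#entries≡V 1)) (n1+b≡n no2)) )
      , K₂⇒Conditions k₂)
    (λ ((_ , #4 , _) , cs) →
      V≡0⇒No (n2≡0 (Equivalence.from (+≡+-- (2 * b + 2)) (trans #4 (-‿-‿+ n (2 * b) 2))))
      , Conditions⇒tight cs , Conditions⇒no14⊎no33 cs)
    where
    -- By `n-count`, `n₂ + n₄ = n - 2b - 2`, and the prescribed number of entries 4 already uses
    -- this up.
    n2≡0 : #entries G 4 + (2 * b + 2) ≡ n → V (is 2) ≡ 0
    n2≡0 eq = combine _ _ (sym n-count) (combine _ _ (sym eq) (combine _ _ (#entries≡V 4)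
      (arith (V (is 2)) (V (is 4)) (#entries G 4) b n)))
      where
      arith : ∀ q s e b n → q + n + (e + (2 * b + 2)) + s ≡ 0 + (q + 2 * b + 2 + s) + n + e
      arith = solve-∀

  integer-form : ∀ {X} x {K BT : Set} → K ⇔ BT → M₂ G + x ≤ X → M₂ G + x ≡ X ⇔ K →
                 + M₂ G ≤ℤ + X -ℤ + x × (+ M₂ G ≡ + X -ℤ + x ⇔ BT)
  integer-form x K⇔BT bound attained =
    +≤+-- x bound , mk⇔ (Equivalence.to K⇔BT ∘ Equivalence.to attained ∘ Equivalence.from (+≡+-- x))
                        (Equivalence.to (+≡+-- x) ∘ Equivalence.from attained ∘ Equivalence.from K⇔BT)

theorem4 : (n b : ℕ) → 1 ≤ b → 2 * b + 2 < n →
    (T : SimpleGraph (Fin n)) → CT* T b →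
    (5 * b + 4 ≤ n →
    + M₂ T ≤ℤ + (4 * n + 16 * b) -ℤ + 12
    × (+ M₂ T ≡ + (4 * n + 16 * b) -ℤ + 12 ⇔ BT₁′ T b))
    × (n < 5 * b + 4 → 3 * b + 2 < n →
    + M₂ T ≤ℤ + (6 * n + 6 * b) -ℤ + 20
    × (+ M₂ T ≡ + (6 * n + 6 * b) -ℤ + 20 ⇔ BT₁′ T b))
    × (n ≤ 3 * b + 2 → 7 * b + 4 < 3 * n →
    + M₂ T ≤ℤ + (10 * n) -ℤ + (6 * b) -ℤ + 28
    × (+ M₂ T ≡ + (10 * n) -ℤ + (6 * b) -ℤ + 28 ⇔ BT₂′ T b))
    × (3 * n ≤ 7 * b + 4 → 2 * b + 2 < n →
    + M₂ T ≤ℤ + (16 * n) -ℤ + (20 * b) -ℤ + 36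
    × (+ M₂ T ≡ + (16 * n) -ℤ + (20 * b) -ℤ + 36 ⇔ BT₂′ T b))
theorem4 n b 1≤b 2b+2<n T ct* =
    -- The first bound is at most the second exactly when `5b + 4 ≤ n`.
    (λ 5b+4≤n → integer-form T 1≤b 2b+2<n ct* 12 (K₁⇔BT₁′ T 1≤b 2b+2<n ct*) (proj₁ case₁)
      (least-bound (M₂ T) (proj₁ case₁) (+2*-mono (4 * n + 6 * b + 12) (at-5b+4 n b) (at-n₁ n b) 5b+4≤n) equality₁ equality₂))
  , (λ n<5b+4 _ → integer-form T 1≤b 2b+2<n ct* 20 (K₁⇔BT₁′ T 1≤b 2b+2<n ct* ⇔-∘ swap) (proj₁ case₂)
      (least-bound (M₂ T) (proj₁ case₂) (+2*-mono (4 * n + 6 * b + 12) (at-n₁ n b) (at-5b+4 n b) (<⇒≤ n<5b+4)) equality₂ equality₁))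
  -- The third bound is at most the fourth exactly when `7b + 4 ≤ 3n`.
  , (λ _ 7b+4<3n → subst (λ i → + M₂ T ≤ℤ i × (+ M₂ T ≡ i ⇔ BT₂′ T b)) (sym (-‿-‿+ (10 * n) (6 * b) 28))
      (integer-form T 1≤b 2b+2<n ct* (6 * b + 28) (K₂⇔BT₂′ T 1≤b 2b+2<n ct* ⇔-∘ swap) (proj₁ case₃)
        (least-bound (M₂ T) (proj₁ case₃) (+2*-mono (10 * n + 6 * b + 28) (at-7b+4 n b) (at-3n n b) (<⇒≤ 7b+4<3n)) equality₃ equality₄)))
  , (λ 3n≤7b+4 _ → subst (λ i → + M₂ T ≤ℤ i × (+ M₂ T ≡ i ⇔ BT₂′ T b)) (sym (-‿-‿+ (16 * n) (20 * b) 36))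
      (integer-form T 1≤b 2b+2<n ct* (20 * b + 36) (K₂⇔BT₂′ T 1≤b 2b+2<n ct*) (proj₁ case₄)
        (least-bound (M₂ T) (proj₁ case₄) (+2*-mono (10 * n + 6 * b + 28) (at-3n n b) (at-7b+4 n b) 3n≤7b+4) equality₄ equality₃)))
  where
  open Characterisation T 1≤b 2b+2<n ct*

  swap : {A B C D : Set} → (A × B × (C ⊎ D)) ⇔ (A × B × (D ⊎ C))
  swap = mk⇔ (Product.map₂ (Product.map₂ Sum.swap)) (Product.map₂ (Product.map₂ Sum.swap))

  at-5b+4 : ∀ n b → 4 * n + 16 * b + 20 ≡ 4 * n + 6 * b + 12 + 2 * (5 * b + 4)
  at-5b+4 = solve-∀
  at-n₁ : ∀ n b → 6 * n + 6 * b + 12 ≡ 4 * n + 6 * b + 12 + 2 * n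
  at-n₁ = solve-∀
  at-7b+4 : ∀ n b → 10 * n + (20 * b + 36) ≡ 10 * n + 6 * b + 28 + 2 * (7 * b + 4)
  at-7b+4 = solve-∀
  at-3n : ∀ n b → 16 * n + (6 * b + 28) ≡ 10 * n + 6 * b + 28 + 2 * (3 * n)
  at-3n = solve-∀
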